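{- Let $F=\mathbb{F}_q$ be the finite field with $q$ elements and let $L/F$ be an infinite field extension such that no element of $L\setminus F$ is algebraic over $F$. Let $S,T$ be finite-dimensional $F$-subspaces of $L$ such that $\dim(S)\ge 2$, $\dim(T)\ge 2$ and $$\dim(ST)=\dim(S)+\dim(T)-1.$$ Then there exist $g,g',a\in L$ such that $\{g,ga,\ldots,ga^{\dim(S)-1}\}$ is a basis of $S$ and $\{g',g'a,\ldots,g'a^{\dim(T)-1}\}$ is a basis of $T$.
   Context: All dimensions are over $F$. For $F$-subspaces $S,T$ of $L$, $ST$ denotes the $F$-linear span of the products $st$, $s\in S$, $t\in T$. -}

module Defs where

open import Level using (_⊔_)
open import Algebra.Bundles using (CommutativeRing)
import Algebra.Bundles
open import Data.Nat using (ℕ; suc) renaming (_*_ to _*ℕ_)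
open import Data.Fin using (Fin; toℕ; remQuot)
open import Data.Product using (Σ; ∃; _×_; proj₁; proj₂)
open import Relation.Nullary using (¬_)
open import Relation.Binary.PropositionalEquality using (_≡_)

module FieldTheory {c ℓ} (L : CommutativeRing c ℓ) where
  open CommutativeRing L
  open import Algebra.Definitions.RawMonoid +-rawMonoid using (sum)
  open import Algebra.Definitions.RawSemiring (Algebra.Bundles.Semiring.rawSemiring semiring) using (_^_)

  IsField : Set (c ⊔ ℓ)
  IsField = (¬ (1# ≈ 0#)) × (∀ x → ¬ (x ≈ 0#) → ∃ λ y → x * y ≈ 1#)

  -- ι : Fin q → L enumerates (injectively) a subfield F of L with exactly
  -- q elements; i.e. F ≅ 𝔽_q is a finite subfield of L of order q.
  record IsFiniteSubfield (q : ℕ) (ι : Fin q → Carrier) : Set (c ⊔ ℓ) where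
    field
      injective  : ∀ i j → ι i ≈ ι j → i ≡ j
      zero-mem   : ∃ λ i → ι i ≈ 0#
      one-mem    : ∃ λ i → ι i ≈ 1#
      +-closed   : ∀ i j → ∃ λ k → ι k ≈ ι i + ι j
      neg-closed : ∀ i → ∃ λ k → ι k ≈ - ι i
      *-closed   : ∀ i j → ∃ λ k → ι k ≈ ι i * ι j
      inv-closed : ∀ i → ¬ (ι i ≈ 0#) → ∃ λ k → ι i * ι k ≈ 1#

  module Over (q : ℕ) (ι : Fin q → Carrier) where

    InF : Carrier → Set ℓ
    InF x = ∃ λ i → x ≈ ι i

    lincomb : ∀ {n} → (Fin n → Carrier) → (Fin n → Fin q) → Carrier
    lincomb v k = sum (λ i → ι (k i) * v i)

    InSpan : ∀ {n} → (Fin n → Carrier) → Carrier → Set ℓ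
    InSpan v x = ∃ λ k → x ≈ lincomb v k

    LinIndep : ∀ {n} → (Fin n → Carrier) → Set ℓ
    LinIndep v = ∀ k → lincomb v k ≈ 0# → ∀ i → ι (k i) ≈ 0#

    IsBasisOf : ∀ {d n} → (Fin d → Carrier) → (Fin n → Carrier) → Set ℓ
    IsBasisOf w v = LinIndep w × (∀ i → InSpan v (w i)) × (∀ j → InSpan w (v j))

    HasDim : ∀ {n} → (Fin n → Carrier) → ℕ → Set (c ⊔ ℓ)
    HasDim v d = Σ (Fin d → Carrier) λ w → IsBasisOf w v

    -- the family of all products sᵢ tⱼ (it spans ST)
    products : ∀ {m n} → (Fin m → Carrier) → (Fin n → Carrier) → Fin (m *ℕ n) → Carrier
    products {m} {n} s t k = s (proj₁ (remQuot n k)) * t (proj₂ (remQuot {m} n k))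

    Algebraic : Carrier → Set ℓ
    Algebraic x = ∃ λ (n : ℕ) → Σ (Fin (suc n) → Fin q) λ k →
      (∃ λ i → ¬ (ι (k i) ≈ 0#)) × (sum (λ i → ι (k i) * (x ^ toℕ i)) ≈ 0#)

    InfiniteExtension : Set (c ⊔ ℓ)
    InfiniteExtension = ∀ n (v : Fin n → Carrier) → ∃ λ x → ¬ (InSpan v x)

    geom : (d : ℕ) → Carrier → Carrier → Fin d → Carrier
    geom d g a i = g * (a ^ toℕ i)

{-# OPTIONS --safe #-}
-- The linear Dyson transform (S + yT , T ∩ y⁻¹S) gives dim ST ≥ dim S + dim T − 1. Call X critical
-- if dim XT = dim X + dim T − 1. Sums and nonzero intersections of critical spaces are critical, so
-- every translate yX of a critical X of least dimension d ≥ 2 is contained in each critical space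
-- that it meets in dimension at least 2. If d ≥ 3, it follows that X² = wX + zX for all independent
-- w, z ∈ X, that the spaces Xʲ have dimension j(d−1) + 1, and that z ∈ X behaves as a prime of
-- degree 1 of the graded ring ⊕Xʲ, with a residue field of q^(d−1) elements. With M = q^(d−1) − 1,
-- Fermat's little theorem makes u^M − v^M, of degree M, divisible by M + 1 pairwise coprime elements
-- of X, so u^M = v^M and u/v is algebraic, a contradiction. Hence d = 2: X is spanned by g and ga,
-- which forces T, and then S, to be spanned by a geometric progression of ratio a.
--
-- Equality in L need not be decidable, so all this takes place under a double negation. This is
-- harmless in the end: the existence of the progressions can be tested by a finite search, since
-- equality is decidable inside S, T and ST.
module Submission where

open import Defs
open import Level as Level using (_⊔_) renaming (suc to lsuc)
open import Algebra.Bundles using (CommutativeRing)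
open import Function using (_∘_; id)
open import Data.Empty using (⊥)
open import Data.Nat as ℕ using (ℕ; zero; suc; _≤_; _<_; z≤n; s≤s)
open import Data.Nat.Properties as ℕₚ using ()
open import Data.Nat.Tactic.RingSolver using (solve-∀)
open import Data.Fin as Fin using (Fin; zero; suc; toℕ; finToFun; funToFin; combine; punchIn; punchOut)
open import Data.Fin.Properties as Finₚ using (_≟_)
open import Data.Fin.Permutation using (Permutation; permutation; _⟨$⟩ʳ_)
open import Data.Vec.Functional using ([]; _∷_)
open import Data.Product using (∃; _×_; _,_; proj₁; proj₂)
open import Relation.Nullary using (¬_; Dec; yes; no; contradiction)
open import Relation.Nullary.Decidable using (¬?; _×-dec_; decidable-stable; ¬¬-excluded-middle)
open import Relation.Binary.PropositionalEquality as ≡ using (_≡_)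

-- Double negation and finite combinatorics

infixl 1 _>>=_

_>>=_ : ∀ {a b} {A : Set a} {B : Set b} → ¬ ¬ A → (A → ¬ ¬ B) → ¬ ¬ B
(m >>= f) k = m (λ x → f x k)

return : ∀ {a} {A : Set a} → A → ¬ ¬ A
return x k = k x

em : ∀ {a} (A : Set a) → ¬ ¬ Dec A
em A = ¬¬-excluded-middle

-- Constructively available for finite families only, which is why later arguments pass to basis
-- vectors before invoking it.
¬¬-choice : ∀ {a n} {P : Fin n → Set a} → (∀ i → ¬ ¬ P i) → ¬ ¬ (∀ i → P i)
¬¬-choice {n = zero}  f = return λ ()
¬¬-choice {n = suc n} f = do
  p ← f zero
  ps ← ¬¬-choice (f ∘ suc)
  return λ { zero → p ; (suc i) → ps i }

funToFin-cong : ∀ {m n} {f g : Fin m → Fin n} → (∀ i → f i ≡ g i) → funToFin f ≡ funToFin g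
funToFin-cong {zero}  eq = ≡.refl
funToFin-cong {suc m} eq = ≡.cong₂ combine (eq zero) (funToFin-cong (eq ∘ suc))

finToFun-injective : ∀ {m n} (i j : Fin (n ℕ.^ m)) →
                     (∀ k → finToFun {n} {m} i k ≡ finToFun j k) → i ≡ j
finToFun-injective {m} {n} i j eq =
  ≡.trans (≡.sym (Finₚ.funToFin-finToFin {m} {n} i))
    (≡.trans (funToFin-cong eq) (Finₚ.funToFin-finToFin {m} {n} j))

-- Functions are coded by numbers. A decoded function agrees with the original one only pointwise,
-- hence the closure condition on `P`.
any-fun? : ∀ {a m n} {P : (Fin m → Fin n) → Set a} →
           (∀ {f g} → (∀ i → f i ≡ g i) → P f → P g) →
           (∀ f → Dec (P f)) → Dec (∃ P)
any-fun? {m = m} {n} resp P? with Finₚ.any? (λ i → P? (finToFun {n} {m} i))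
... | yes (i , p) = yes (finToFun i , p)
... | no ¬p = no λ { (f , p) →
  ¬p (funToFin f , resp (λ i → ≡.sym (Finₚ.finToFun-funToFin f i)) p) }

-- The inverse is found by search, which succeeds by pigeonhole: if `j` were missed, punching it out
-- would inject `Fin (suc m)` into `Fin m`.
injective⇒permutation : ∀ {n} (f : Fin n → Fin n) → (∀ {i j} → f i ≡ f j → i ≡ j) →
                        ∃ λ (π : Permutation n n) → ∀ i → π ⟨$⟩ʳ i ≡ f i
injective⇒permutation {n} f inj =
  permutation f (λ j → proj₁ (hit j)) (λ j → proj₂ (hit j)) (λ i → inj (proj₂ (hit (f i)))) ,
  λ _ → ≡.refl
  where
  avoid : ∀ {m} (g : Fin m → Fin m) → (∀ {i j} → g i ≡ g j → i ≡ j) → ∀ j → ¬ ¬ (∃ λ i → g i ≡ j)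
  avoid {suc m} g g-inj j missed = contradiction (Finₚ.injective⇒≤ punched-injective) ℕₚ.1+n≰n
    where
    avoids : ∀ i → ¬ (j ≡ g i)
    avoids i e = missed (i , ≡.sym e)
    punched : Fin (suc m) → Fin m
    punched i = punchOut (avoids i)
    punched-injective : ∀ {i k} → punched i ≡ punched k → i ≡ k
    punched-injective {i} {k} e = g-inj (Finₚ.punchOut-injective (avoids i) (avoids k) e)
  hit : ∀ j → ∃ λ i → f i ≡ j
  hit j = decidable-stable (Finₚ.any? (λ i → f i ≟ j)) (avoid f inj j)

-- Arithmetic in L and in the finite subfield F

module LinearAlgebra {c ℓ} (L : CommutativeRing c ℓ) (isField : FieldTheory.IsField L)
  (q : ℕ) (ι : Fin q → CommutativeRing.Carrier L)
  (isSubfield : FieldTheory.IsFiniteSubfield L q ι) where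

  open CommutativeRing L hiding (zero)
  open FieldTheory L
  open Over q ι
  open IsFiniteSubfield isSubfield
  open import Algebra.Properties.Ring ring
  open import Algebra.Properties.Semiring.Sum semiring
    using (sum; sum-cong-≋; ∑-distrib-+; *-distribˡ-sum)
  open import Algebra.Solver.Ring.NaturalCoefficients.Default commutativeSemiring
    using (solve; _:=_; _:+_; _:*_)
  open import Relation.Binary.Reasoning.Setoid setoid

  1≉0 : 1# ≉ 0#
  1≉0 = proj₁ isField

  inverse : ∀ {x} → x ≉ 0# → ∃ λ y → x * y ≈ 1#
  inverse = proj₂ isField _

  *-cancelˡ : ∀ {x y z} → x ≉ 0# → x * y ≈ x * z → y ≈ z
  *-cancelˡ {x} {y} {z} x≉0 eq with x⁻¹ , inv ← inverse x≉0 = begin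
    y              ≈⟨ cancel y ⟨
    x⁻¹ * (x * y)  ≈⟨ *-congˡ eq ⟩
    x⁻¹ * (x * z)  ≈⟨ cancel z ⟩
    z              ∎
    where
    cancel : ∀ y → x⁻¹ * (x * y) ≈ y
    cancel y = begin
      x⁻¹ * (x * y)  ≈⟨ solve 3 (λ x x⁻¹ y → x⁻¹ :* (x :* y) := (x :* x⁻¹) :* y) refl x x⁻¹ y ⟩
      (x * x⁻¹) * y  ≈⟨ *-congʳ inv ⟩
      1# * y         ≈⟨ *-identityˡ y ⟩
      y              ∎

  x*y≈0⇒y≈0 : ∀ {x y} → x ≉ 0# → x * y ≈ 0# → y ≈ 0#
  x*y≈0⇒y≈0 x≉0 eq = *-cancelˡ x≉0 (trans eq (sym (zeroʳ _)))

  *-≉0 : ∀ {x y} → x ≉ 0# → y ≉ 0# → x * y ≉ 0#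
  *-≉0 x≉0 y≉0 eq = y≉0 (x*y≈0⇒y≈0 x≉0 eq)

  x-y≈0⇒x≈y : ∀ {x y} → x - y ≈ 0# → x ≈ y
  x-y≈0⇒x≈y {x} {y} eq = trans (+-inverseˡ-unique x (- y) eq) (-‿involutive y)

  y+[x-y]≈x : ∀ x y → y + (x - y) ≈ x
  y+[x-y]≈x x y = trans (+-comm y (x - y)) (trans (+-assoc x (- y) y)
    (trans (+-congˡ (-‿inverseˡ y)) (+-identityʳ x)))

  x≈y+z⇒x-y≈z : ∀ {x y z} → x ≈ y + z → x - y ≈ z
  x≈y+z⇒x-y≈z {x} {y} {z} eq = +-cancelˡ y _ _ (trans (y+[x-y]≈x x y) eq)

  isolate : ∀ {k a x s} → k * a ≈ 1# → k * x + s ≈ 0# → x ≈ - (a * s)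
  isolate {k} {a} {x} {s} inv eq = +-inverseˡ-unique x (a * s) (begin
    x + a * s          ≈⟨ +-congʳ (*-identityˡ x) ⟨
    1# * x + a * s     ≈⟨ +-congʳ (*-congʳ inv) ⟨
    k * a * x + a * s  ≈⟨ solve 4 (λ k a x s → k :* a :* x :+ a :* s := a :* (k :* x :+ s)) refl k a x s ⟩
    a * (k * x + s)    ≈⟨ *-congˡ eq ⟩
    a * 0#             ≈⟨ zeroʳ a ⟩
    0#                 ∎)

  F-resp : ∀ {x y} → x ≈ y → InF x → InF y
  F-resp x≈y (i , eq) = i , trans (sym x≈y) eq

  0∈F : InF 0#
  0∈F = proj₁ zero-mem , sym (proj₂ zero-mem)

  1∈F : InF 1#
  1∈F = proj₁ one-mem , sym (proj₂ one-mem)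

  F-+ : ∀ {x y} → InF x → InF y → InF (x + y)
  F-+ (i , p) (j , r) with k , eq ← +-closed i j = k , trans (+-cong p r) (sym eq)

  F-* : ∀ {x y} → InF x → InF y → InF (x * y)
  F-* (i , p) (j , r) with k , eq ← *-closed i j = k , trans (*-cong p r) (sym eq)

  F-neg : ∀ {x} → InF x → InF (- x)
  F-neg (i , p) with k , eq ← neg-closed i = k , trans (-‿cong p) (sym eq)

  -1∈F : InF (- 1#)
  -1∈F = F-neg 1∈F

  F-≟ : ∀ {x y} → InF x → InF y → Dec (x ≈ y)
  F-≟ (i , p) (j , r) with i ≟ j
  ... | yes ≡.refl = yes (trans p (sym r))
  ... | no i≢j = no λ eq → i≢j (injective i j (trans (sym p) (trans eq r)))

  F-inverse : ∀ {x} → InF x → x ≉ 0# → ∃ λ y → InF y × x * y ≈ 1#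
  F-inverse (i , p) x≉0 with k , eq ← inv-closed i (λ ιi≈0 → x≉0 (trans p ιi≈0)) =
    ι k , (k , refl) , trans (*-congʳ p) eq

  -- Witnessed by 0 and 1. It makes `q ^ n < q ^ m` for n < m, on which the counting in `dependent`
  -- relies.
  1<q : 1 < q
  1<q = two zero-mem one-mem
    where
    two : (∃ λ i → ι i ≈ 0#) → (∃ λ i → ι i ≈ 1#) → 1 < q
    two (i , p) (j , r) = Finₚ.injective⇒≤ {f = pick} pick-injective
      where
      i≢j : ¬ (i ≡ j)
      i≢j ≡.refl = 1≉0 (trans (sym r) p)
      pick : Fin 2 → Fin q
      pick zero = i
      pick (suc zero) = j
      pick-injective : ∀ {x y} → pick x ≡ pick y → x ≡ y
      pick-injective {zero} {zero} _ = ≡.refl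
      pick-injective {zero} {suc zero} e = contradiction e i≢j
      pick-injective {suc zero} {zero} e = contradiction (≡.sym e) i≢j
      pick-injective {suc zero} {suc zero} _ = ≡.refl

  -- Linear combinations and subspaces

  AllF : ∀ {n} → (Fin n → Carrier) → Set ℓ
  AllF k = ∀ i → InF (k i)

  -- Coefficients are elements of L accompanied by `AllF`, not indices as in `lincomb`, so that they
  -- can be added and multiplied without recoding.
  comb : ∀ {n} → (Fin n → Carrier) → (Fin n → Carrier) → Carrier
  comb k w = sum (λ i → k i * w i)

  comb-cong : ∀ {n} {k l w : Fin n → Carrier} → (∀ i → k i ≈ l i) → comb k w ≈ comb l w
  comb-cong eq = sum-cong-≋ (λ i → *-congʳ (eq i))

  comb-+ : ∀ {n} (k l w : Fin n → Carrier) → comb k w + comb l w ≈ comb (λ i → k i + l i) w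
  comb-+ k l w = trans (sym (∑-distrib-+ (λ i → k i * w i) (λ i → l i * w i)))
    (sum-cong-≋ (λ i → sym (distribʳ (w i) (k i) (l i))))

  comb-* : ∀ {n} x (k w : Fin n → Carrier) → x * comb k w ≈ comb (λ i → x * k i) w
  comb-* x k w = trans (*-distribˡ-sum x (λ i → k i * w i))
    (sum-cong-≋ (λ i → sym (*-assoc x (k i) (w i))))

  comb-scaleʳ : ∀ {n} x (k w : Fin n → Carrier) → x * comb k w ≈ comb k (λ i → x * w i)
  comb-scaleʳ x k w = trans (*-distribˡ-sum x (λ i → k i * w i))
    (sum-cong-≋ (λ i → solve 3 (λ x k w → x :* (k :* w) := k :* (x :* w)) refl x (k i) (w i)))

  comb-- : ∀ {n} (k l w : Fin n → Carrier) → comb k w - comb l w ≈ comb (λ i → k i - l i) w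
  comb-- k l w = begin
    comb k w - comb l w                        ≈⟨ +-congˡ (-1*x≈-x _) ⟨
    comb k w + - 1# * comb l w                 ≈⟨ +-congˡ (comb-* (- 1#) l w) ⟩
    comb k w + comb (λ i → - 1# * l i) w       ≈⟨ comb-+ k _ w ⟩
    comb (λ i → k i + - 1# * l i) w            ≈⟨ comb-cong (λ i → +-congˡ (-1*x≈-x (l i))) ⟩
    comb (λ i → k i - l i) w                   ∎

  comb-zero : ∀ {n} {k : Fin n → Carrier} (w : Fin n → Carrier) → (∀ i → k i ≈ 0#) → comb k w ≈ 0#
  comb-zero {zero} w eq = refl
  comb-zero {suc n} w eq =
    trans (+-cong (trans (*-congʳ (eq zero)) (zeroˡ _)) (comb-zero (w ∘ suc) (eq ∘ suc))) (+-identityˡ 0#)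

  -- A predicate without a basis, so that sums and intersections are formed freely; a basis is
  -- separate data, `Dim`, often available only under double negation.
  record Subspace : Set (lsuc (c ⊔ ℓ)) where
    no-eta-equality
    field
      Mem    : Carrier → Set (c ⊔ ℓ)
      resp   : ∀ {x y} → x ≈ y → Mem x → Mem y
      0-mem  : Mem 0#
      +-mem  : ∀ {x y} → Mem x → Mem y → Mem (x + y)
      ·-mem  : ∀ {a x} → InF a → Mem x → Mem (a * x)

    neg-mem : ∀ {x} → Mem x → Mem (- x)
    neg-mem x∈ = resp (-1*x≈-x _) (·-mem -1∈F x∈)

    minus-mem : ∀ {x y} → Mem x → Mem y → Mem (x - y)
    minus-mem x∈ y∈ = +-mem x∈ (neg-mem y∈)

    comb-mem : ∀ {n} (k w : Fin n → Carrier) → AllF k → (∀ i → Mem (w i)) → Mem (comb k w)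
    comb-mem {zero} k w kF w∈ = 0-mem
    comb-mem {suc n} k w kF w∈ =
      +-mem (·-mem (kF zero) (w∈ zero)) (comb-mem (k ∘ suc) (w ∘ suc) (kF ∘ suc) (w∈ ∘ suc))

  open Subspace public

  infix 4 _∈_ _∉_ _⊆_
  _∈_ _∉_ : Carrier → Subspace → Set (c ⊔ ℓ)
  x ∈ V = Mem V x
  x ∉ V = ¬ (x ∈ V)

  _⊆_ : Subspace → Subspace → Set (c ⊔ ℓ)
  V ⊆ W = ∀ {x} → x ∈ V → x ∈ W

  span : ∀ {n} → (Fin n → Carrier) → Subspace
  Mem (span w) x = ∃ λ k → AllF k × x ≈ comb k w
  resp (span w) x≈y (k , kF , eq) = k , kF , trans (sym x≈y) eq
  0-mem (span w) = (λ _ → 0#) , (λ _ → 0∈F) , sym (comb-zero w (λ _ → refl))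
  +-mem (span w) (k , kF , eq) (l , lF , eq′) =
    (λ i → k i + l i) , (λ i → F-+ (kF i) (lF i)) , trans (+-cong eq eq′) (comb-+ k l w)
  ·-mem (span w) {a} aF (k , kF , eq) =
    (λ i → a * k i) , (λ i → F-* aF (kF i)) , trans (*-congˡ eq) (comb-* a k w)

  span-⊆ : ∀ {n} {w : Fin n → Carrier} V → (∀ i → w i ∈ V) → span w ⊆ V
  span-⊆ {w = w} V w∈ (k , kF , eq) = resp V (sym eq) (comb-mem V k w kF w∈)

  span-tail : ∀ {n} (w : Fin (suc n) → Carrier) → span (w ∘ suc) ⊆ span w
  span-tail w (k , kF , eq) = (0# ∷ k) , (λ { zero → 0∈F ; (suc i) → kF i }) ,
    trans eq (sym (trans (+-congʳ (zeroˡ _)) (+-identityˡ _)))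

  span-gen : ∀ {n} (w : Fin n → Carrier) i → w i ∈ span w
  span-gen w zero = (1# ∷ λ _ → 0#) , (λ { zero → 1∈F ; (suc _) → 0∈F }) ,
    sym (trans (+-cong (*-identityˡ _) (comb-zero (w ∘ suc) (λ _ → refl))) (+-identityʳ _))
  span-gen w (suc i) = span-tail w (span-gen (w ∘ suc) i)

  infixl 6 _⊕_
  infixl 7 _⊓_
  infixr 8 _∙_

  _⊕_ : Subspace → Subspace → Subspace
  Mem (V ⊕ W) x = ∃ λ v → ∃ λ w → v ∈ V × w ∈ W × x ≈ v + w
  resp (V ⊕ W) x≈y (v , w , v∈ , w∈ , eq) = v , w , v∈ , w∈ , trans (sym x≈y) eq
  0-mem (V ⊕ W) = 0# , 0# , 0-mem V , 0-mem W , sym (+-identityˡ 0#)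
  +-mem (V ⊕ W) (v , w , v∈ , w∈ , eq) (v′ , w′ , v′∈ , w′∈ , eq′) =
    v + v′ , w + w′ , +-mem V v∈ v′∈ , +-mem W w∈ w′∈ ,
    trans (+-cong eq eq′)
      (solve 4 (λ v w v′ w′ → (v :+ w) :+ (v′ :+ w′) := (v :+ v′) :+ (w :+ w′)) refl v w v′ w′)
  ·-mem (V ⊕ W) {a} aF (v , w , v∈ , w∈ , eq) =
    a * v , a * w , ·-mem V aF v∈ , ·-mem W aF w∈ , trans (*-congˡ eq) (distribˡ a v w)

  _⊓_ : Subspace → Subspace → Subspace
  Mem (V ⊓ W) x = x ∈ V × x ∈ W
  resp (V ⊓ W) x≈y (x∈V , x∈W) = resp V x≈y x∈V , resp W x≈y x∈W
  0-mem (V ⊓ W) = 0-mem V , 0-mem W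
  +-mem (V ⊓ W) (x∈V , x∈W) (y∈V , y∈W) = +-mem V x∈V y∈V , +-mem W x∈W y∈W
  ·-mem (V ⊓ W) aF (x∈V , x∈W) = ·-mem V aF x∈V , ·-mem W aF x∈W

  _∙_ : Carrier → Subspace → Subspace
  Mem (y ∙ V) x = ∃ λ v → v ∈ V × x ≈ y * v
  resp (y ∙ V) x≈z (v , v∈ , eq) = v , v∈ , trans (sym x≈z) eq
  0-mem (y ∙ V) = 0# , 0-mem V , sym (zeroʳ y)
  +-mem (y ∙ V) (v , v∈ , eq) (w , w∈ , eq′) =
    v + w , +-mem V v∈ w∈ , trans (+-cong eq eq′) (sym (distribˡ y v w))
  ·-mem (y ∙ V) {a} aF (v , v∈ , eq) = a * v , ·-mem V aF v∈ ,
    trans (*-congˡ eq) (solve 3 (λ a y v → a :* (y :* v) := y :* (a :* v)) refl a y v)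

  -- For nonzero `y` this is y⁻¹V, expressed without the inverse.
  colon : Subspace → Carrier → Subspace
  Mem (colon V y) x = y * x ∈ V
  resp (colon V y) x≈z = resp V (*-congˡ x≈z)
  0-mem (colon V y) = resp V (sym (zeroʳ y)) (0-mem V)
  +-mem (colon V y) p r = resp V (sym (distribˡ y _ _)) (+-mem V p r)
  ·-mem (colon V y) {a} {x} aF p =
    resp V (solve 3 (λ a y x → a :* (y :* x) := y :* (a :* x)) refl a y x) (·-mem V aF p)

  line : Carrier → Subspace
  Mem (line y) x = Level.Lift c (∃ λ a → InF a × x ≈ a * y)
  resp (line y) x≈z (Level.lift (a , aF , eq)) = Level.lift (a , aF , trans (sym x≈z) eq)
  0-mem (line y) = Level.lift (0# , 0∈F , sym (zeroˡ y))
  +-mem (line y) (Level.lift (a , aF , eq)) (Level.lift (b , bF , eq′)) =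
    Level.lift (a + b , F-+ aF bF , trans (+-cong eq eq′) (sym (distribʳ y a b)))
  ·-mem (line y) {b} bF (Level.lift (a , aF , eq)) =
    Level.lift (b * a , F-* bF aF , trans (*-congˡ eq) (sym (*-assoc b a y)))

  line-gen : ∀ x → x ∈ line x
  line-gen x = Level.lift (1# , 1∈F , sym (*-identityˡ x))

  line-⊆ : ∀ {x} V → x ∈ V → line x ⊆ V
  line-⊆ V x∈ (Level.lift (a , aF , eq)) = resp V (sym eq) (·-mem V aF x∈)

  ⊕-inˡ : ∀ V W → V ⊆ V ⊕ W
  ⊕-inˡ V W {x} x∈ = x , 0# , x∈ , 0-mem W , sym (+-identityʳ x)

  ⊕-inʳ : ∀ V W → W ⊆ V ⊕ W
  ⊕-inʳ V W {x} x∈ = 0# , x , 0-mem V , x∈ , sym (+-identityˡ x)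

  ⊕-⊆ : ∀ V W U → V ⊆ U → W ⊆ U → V ⊕ W ⊆ U
  ⊕-⊆ V W U V⊆ W⊆ (v , w , v∈ , w∈ , eq) = resp U (sym eq) (+-mem U (V⊆ v∈) (W⊆ w∈))

  -- Linear independence and dimension

  record Ind {n} (w : Fin n → Carrier) : Set (c ⊔ ℓ) where
    constructor mkInd
    field
      trivial : ∀ k → AllF k → comb k w ≈ 0# → ∀ i → k i ≈ 0#

  open Ind public

  Ind-unique : ∀ {n} {w : Fin n → Carrier} → Ind w → ∀ {k l} → AllF k → AllF l →
               comb k w ≈ comb l w → ∀ i → k i ≈ l i
  Ind-unique {w = w} ind {k} {l} kF lF eq i = x-y≈0⇒x≈y
    (trivial ind (λ i → k i - l i) (λ i → F-+ (kF i) (F-neg (lF i)))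
      (trans (sym (comb-- k l w)) (trans (+-congʳ eq) (-‿inverseʳ _))) i)

  Ind-[] : (w : Fin 0 → Carrier) → Ind w
  Ind-[] w = mkInd λ k kF eq ()

  Ind-∷ : ∀ {n} {w : Fin n → Carrier} {x} → Ind w → x ∉ span w → Ind (x ∷ w)
  Ind-∷ {n} {w} {x} ind x∉ = mkInd λ k kF eq → result k kF eq (F-≟ (kF zero) 0∈F)
    where
    module _ (k : Fin (suc n) → Carrier) (kF : AllF k) (eq : comb k (x ∷ w) ≈ 0#) where
      tail-zero : k zero ≈ 0# → ∀ i → k (suc i) ≈ 0#
      tail-zero k₀≈0 = trivial ind (k ∘ suc) (kF ∘ suc) (begin
        comb (k ∘ suc) w              ≈⟨ +-identityˡ _ ⟨
        0# + comb (k ∘ suc) w         ≈⟨ +-congʳ (zeroˡ x) ⟨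
        0# * x + comb (k ∘ suc) w     ≈⟨ +-congʳ (*-congʳ k₀≈0) ⟨
        k zero * x + comb (k ∘ suc) w ≈⟨ eq ⟩
        0#                            ∎)
      result : Dec (k zero ≈ 0#) → ∀ i → k i ≈ 0#
      result (yes k₀≈0) zero = k₀≈0
      result (yes k₀≈0) (suc i) = tail-zero k₀≈0 i
      result (no k₀≉0) with a , aF , inv ← F-inverse (kF zero) k₀≉0 =
        contradiction (resp (span w) (sym (isolate inv eq))
          (neg-mem (span w) (·-mem (span w) aF (k ∘ suc , kF ∘ suc , refl)))) x∉

  Ind-tail : ∀ {n} {w : Fin (suc n) → Carrier} → Ind w → Ind (w ∘ suc)
  Ind-tail {w = w} ind = mkInd λ k kF eq i → trivial ind (0# ∷ k) (λ { zero → 0∈F ; (suc i) → kF i })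
    (trans (+-cong (zeroˡ (w zero)) eq) (+-identityˡ 0#)) (suc i)

  Ind-head : ∀ {n} {w : Fin (suc n) → Carrier} → Ind w → w zero ∉ span (w ∘ suc)
  Ind-head {w = w} ind (k , kF , eq) = 1≉0 (trans (sym (-‿involutive 1#))
    (trans (-‿cong (trivial ind (- 1# ∷ k) (λ { zero → -1∈F ; (suc i) → kF i })
      (trans (+-cong (-1*x≈-x (w zero)) (sym eq)) (-‿inverseˡ (w zero))) zero)) -0#≈0#))

  Ind-≉0 : ∀ {n} {w : Fin n → Carrier} → Ind w → ∀ i → w i ≉ 0#
  Ind-≉0 {w = w} ind zero eq =
    Ind-head ind (resp (span (w ∘ suc)) (sym eq) (0-mem (span (w ∘ suc))))
  Ind-≉0 {w = w} ind (suc i) = Ind-≉0 (Ind-tail ind) i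

  Ind-scale : ∀ {n} {w : Fin n → Carrier} {y} → y ≉ 0# → Ind w → Ind (λ i → y * w i)
  Ind-scale {w = w} {y} y≉0 ind = mkInd λ k kF eq →
    trivial ind k kF (x*y≈0⇒y≈0 y≉0 (trans (comb-scaleʳ y k w) eq))

  -- Steinitz by counting: a family of m vectors has q ^ m coefficient vectors.
  dependent : ∀ {m n} {v : Fin m → Carrier} {w : Fin n → Carrier} → n < m → (∀ i → v i ∈ span w) →
              ∃ λ k → AllF k × comb k v ≈ 0# × ∃ λ i → k i ≉ 0#
  dependent {m} {n} {v} {w} n<m v∈ = relation (Finₚ.pigeonhole (ℕₚ.^-monoʳ-< q 1<q n<m) (λ i → funToFin (code i)))
    where
    scalars : ∀ {m} → Fin (q ℕ.^ m) → Fin m → Carrier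
    scalars i j = ι (finToFun i j)
    in-span : ∀ i → comb (scalars i) v ∈ span w
    in-span i = comb-mem (span w) (scalars i) v (λ j → finToFun i j , refl) v∈
    code : Fin (q ℕ.^ m) → Fin n → Fin q
    code i j = proj₁ (proj₁ (proj₂ (in-span i)) j)
    decode : ∀ i → comb (scalars i) v ≈ comb (ι ∘ code i) w
    decode i = trans (proj₂ (proj₂ (in-span i))) (comb-cong (λ j → proj₂ (proj₁ (proj₂ (in-span i)) j)))
    -- Two coefficient vectors with equal coordinates in `w` give the same combination of `v`; their
    -- difference is the relation.
    relation : (∃ λ i → ∃ λ j → i Fin.< j × funToFin (code i) ≡ funToFin (code j)) → _
    relation (i , j , i<j , eq) = k , (λ l → F-+ (_ , refl) (F-neg (_ , refl))) ,
      trans (sym (comb-- (scalars i) (scalars j) v)) (trans (+-congʳ same) (-‿inverseʳ _)) ,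
      nonzero (Finₚ.any? (λ l → ¬? (finToFun {q} {m} i l ≟ finToFun j l)))
      where
      k : Fin m → Carrier
      k l = scalars i l - scalars j l
      same-code : ∀ l → code i l ≡ code j l
      same-code l = ≡.trans (≡.sym (Finₚ.finToFun-funToFin (code i) l))
        (≡.trans (≡.cong (λ z → finToFun z l) eq) (Finₚ.finToFun-funToFin (code j) l))
      same : comb (scalars i) v ≈ comb (scalars j) v
      same = trans (decode i) (trans (comb-cong (λ l → reflexive (≡.cong ι (same-code l)))) (sym (decode j)))
      nonzero : Dec (∃ λ l → ¬ (finToFun i l ≡ finToFun j l)) → ∃ λ l → k l ≉ 0#
      nonzero (yes (l , ne)) = l , λ kl≈0 → ne (injective _ _ (x-y≈0⇒x≈y kl≈0))
      nonzero (no none) = contradiction (finToFun-injective {m} {q} i j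
        (λ l → decidable-stable (finToFun i l ≟ finToFun j l) (λ ne → none (l , ne))))
        (λ i≡j → Finₚ.<⇒≢ i<j i≡j)

  Ind-≤ : ∀ {m n} {v : Fin m → Carrier} {w : Fin n → Carrier} → Ind v → (∀ i → v i ∈ span w) → m ≤ n
  Ind-≤ ind v∈ = ℕₚ.≮⇒≥ λ n<m →
    let k , kF , eq , i , ki≉0 = dependent n<m v∈ in ki≉0 (trivial ind k kF eq i)

  record Dim (V : Subspace) (d : ℕ) : Set (c ⊔ ℓ) where
    constructor mkDim
    field
      basis       : Fin d → Carrier
      independent : Ind basis
      contained   : ∀ i → basis i ∈ V
      spanning    : V ⊆ span basis

  open Dim public

  Dim-resp : ∀ {V W d} → V ⊆ W → W ⊆ V → Dim V d → Dim W d
  Dim-resp V⊆W W⊆V (mkDim w ind w∈ ⊆span) = mkDim w ind (λ i → V⊆W (w∈ i)) λ x∈ → ⊆span (W⊆V x∈)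

  Ind-≤-Dim : ∀ {V n m} {v : Fin m → Carrier} → Ind v → (∀ i → v i ∈ V) → Dim V n → m ≤ n
  Ind-≤-Dim ind v∈ dV = Ind-≤ ind (λ i → spanning dV (v∈ i))

  Dim-≤ : ∀ {V W m n} → V ⊆ W → Dim V m → Dim W n → m ≤ n
  Dim-≤ V⊆W dV dW = Ind-≤-Dim (independent dV) (λ i → V⊆W (contained dV i)) dW

  -- Adjoining `x` gives n + 1 vectors in dimension n, hence a relation; its coefficient at `x`
  -- cannot vanish, since `v` is independent.
  Ind-spans : ∀ {V n} {v : Fin n → Carrier} → Ind v → (∀ i → v i ∈ V) → Dim V n → V ⊆ span v
  Ind-spans {V} {n} {v} ind v∈ dV {x} x∈
    with k , kF , eq , nz ← dependent {v = x ∷ v} (ℕₚ.n<1+n n)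
           (λ { zero → spanning dV x∈ ; (suc i) → spanning dV (v∈ i) })
       | F-≟ (kF zero) 0∈F
  ... | yes k₀≈0 = contradiction (proj₂ nz) (λ ne → ne (all-zero (proj₁ nz)))
    where
    all-zero : ∀ i → k i ≈ 0#
    all-zero zero = k₀≈0
    all-zero (suc i) = trivial ind (k ∘ suc) (kF ∘ suc)
      (trans (sym (trans (+-congʳ (trans (*-congʳ k₀≈0) (zeroˡ x))) (+-identityˡ _))) eq) i
  ... | no k₀≉0 with a , aF , inv ← F-inverse (kF zero) k₀≉0 =
    resp (span v) (sym (isolate inv eq)) (neg-mem (span v) (·-mem (span v) aF (k ∘ suc , kF ∘ suc , refl)))

  -- The basis of V is an independent family in W of full length, so it spans W. The contrapositive
  -- yields the strict inequalities of dimension used later.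
  Dim-⊇ : ∀ {V W m n} → V ⊆ W → Dim V m → Dim W n → n ≤ m → W ⊆ V
  Dim-⊇ {V} V⊆W dV dW n≤m x∈ with ℕₚ.≤-antisym n≤m (Dim-≤ V⊆W dV dW)
  ... | ≡.refl = span-⊆ V (contained dV) (Ind-spans (independent dV) (λ i → V⊆W (contained dV i)) dW x∈)

  Dim-unique : ∀ {V m n} → Dim V m → Dim V n → m ≡ n
  Dim-unique dV dV′ = ℕₚ.≤-antisym (Dim-≤ id dV dV′) (Dim-≤ id dV′ dV)

  Dim-span : ∀ {n} {w : Fin n → Carrier} → Ind w → Dim (span w) n
  Dim-span {w = w} ind = mkDim w ind (span-gen w) id

  Dim-line : ∀ {x} → x ≉ 0# → Dim (line x) 1
  Dim-line {x} x≉0 = mkDim (λ _ → x)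
    (mkInd λ { k kF eq zero → x*y≈0⇒y≈0 x≉0 (trans (*-comm x _) (trans (sym (+-identityʳ _)) eq)) })
    (λ _ → line-gen x)
    (λ (Level.lift (a , aF , eq)) → (λ _ → a) , (λ _ → aF) , trans eq (sym (+-identityʳ _)))

  Dim-∙ : ∀ {V d y} → y ≉ 0# → Dim V d → Dim (y ∙ V) d
  Dim-∙ {V} {y = y} y≉0 dV = mkDim (λ i → y * basis dV i)
    (Ind-scale y≉0 (independent dV))
    (λ i → basis dV i , contained dV i , refl)
    (λ (v , v∈ , eq) → let k , kF , eq′ = spanning dV v∈ in
      k , kF , trans eq (trans (*-congˡ eq′) (comb-scaleʳ y k (basis dV))))

  Dim-adjoin : ∀ {V d x} → x ∉ V → Dim V d → Dim (V ⊕ line x) (suc d)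
  Dim-adjoin {V} {x = x} x∉ dV = mkDim (x ∷ basis dV)
    (Ind-∷ (independent dV) (λ x∈ → x∉ (span-⊆ V (contained dV) x∈)))
    (λ { zero → ⊕-inʳ V (line x) (line-gen x) ; (suc i) → ⊕-inˡ V (line x) (contained dV i) })
    (λ (v , y , v∈ , Level.lift (a , aF , yeq) , eq) → let k , kF , veq = spanning dV v∈ in
      (a ∷ k) , (λ { zero → aF ; (suc i) → kF i }) ,
      trans eq (trans (+-cong veq yeq) (+-comm _ _)))

  positive : ∀ {V d x} → x ∈ V → x ≉ 0# → Dim V d → 1 ≤ d
  positive {V} x∈ x≉0 dV = Dim-≤ (line-⊆ V x∈) (Dim-line x≉0) dV

  span-≟ : ∀ {n x y} {w : Fin n → Carrier} → Ind w → x ∈ span w → y ∈ span w → Dec (x ≈ y)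
  span-≟ {w = w} ind (k , kF , xeq) (l , lF , yeq) with Finₚ.all? (λ i → F-≟ (kF i) (lF i))
  ... | yes k≈l = yes (trans xeq (trans (comb-cong k≈l) (sym yeq)))
  ... | no k≉l = no λ x≈y → k≉l (Ind-unique ind kF lF (trans (sym xeq) (trans x≈y yeq)))

  -- All combinations of `v` are tried; the ambient independent family `w` makes the comparisons
  -- decidable.
  ∈-span? : ∀ {m n x} {v : Fin m → Carrier} {w : Fin n → Carrier} → Ind w →
            (∀ i → v i ∈ span w) → x ∈ span w → Dec (x ∈ span v)
  ∈-span? {x = x} {v} {w} ind v∈ x∈
    with any-fun? {P = λ k → x ≈ comb (ι ∘ k) v}
           (λ k≡l eq → trans eq (comb-cong (λ i → reflexive (≡.cong ι (k≡l i)))))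
           (λ k → span-≟ ind x∈ (comb-mem (span w) (ι ∘ k) v (λ i → k i , refl) v∈))
  ... | yes (k , eq) = yes (ι ∘ k , (λ i → k i , refl) , eq)
  ... | no none = no λ (k , kF , eq) →
    none ((λ i → proj₁ (kF i)) , trans eq (comb-cong (λ i → proj₂ (kF i))))

  missing : ∀ {V W m n} → Dim V m → Dim W n → m < n → ¬ ¬ ∃ λ x → x ∈ W × x ∉ V
  missing {V} {W} dV dW m<n none = ¬¬-choice {P = λ i → basis dW i ∈ V}
    (λ i notin → none (basis dW i , contained dW i , notin))
    (λ all → ℕₚ.<⇒≱ m<n (Dim-≤ (λ x∈ → span-⊆ V all (spanning dW x∈)) dW dV))

  -- Independent vectors of V are collected one at a time, at most n of them. Whether one more
  -- exists is settled by `em`, whence the double negation.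
  Dim-exists : ∀ {V W n} → V ⊆ W → Dim W n → ¬ ¬ ∃ λ d → Dim V d
  Dim-exists {V} {W} {n} V⊆W dW = grow n {v = []} (Ind-[] []) (λ ()) (ℕₚ.≤-reflexive (≡.sym (ℕₚ.+-identityʳ n)))
    where
    grow : ∀ fuel {d} {v : Fin d → Carrier} → Ind v → (∀ i → v i ∈ V) → n ≤ fuel ℕ.+ d → ¬ ¬ ∃ λ d → Dim V d
    grow fuel {d} {v} ind v∈ enough = do
      no full ← em (∃ λ x → x ∈ V × x ∉ span v)
        where yes (x , x∈ , x∉) → extend fuel enough x x∈ x∉
      -- `full` says only that no vector of V avoids the span; inside W membership in the span is
      -- decidable, which turns this into an inclusion.
      return (d , mkDim v ind v∈ λ x∈ →
        decidable-stable (∈-span? (independent dW) (λ i → spanning dW (V⊆W (v∈ i))) (spanning dW (V⊆W x∈)))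
          (λ x∉ → full (_ , x∈ , x∉)))
      where
      extend : ∀ fuel → n ≤ fuel ℕ.+ d → ∀ x → x ∈ V → x ∉ span v → ¬ ¬ ∃ λ d → Dim V d
      extend zero enough x x∈ x∉ = contradiction
        (ℕₚ.≤-trans (Ind-≤-Dim {v = x ∷ v} (Ind-∷ ind x∉) (λ { zero → V⊆W x∈ ; (suc i) → V⊆W (v∈ i) }) dW) enough)
        ℕₚ.1+n≰n
      extend (suc fuel) enough x x∈ x∉ = grow fuel {v = x ∷ v} (Ind-∷ ind x∉) (λ { zero → x∈ ; (suc i) → v∈ i })
        (ℕₚ.≤-trans enough (ℕₚ.≤-reflexive (≡.sym (ℕₚ.+-suc fuel d))))

  -- C climbs from A ∩ B to A by one dimension at a time, and C + B grows along with it, so dim(C +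
  -- B) - dim C stays constant.
  modular : ∀ {A B a b i} → Dim A a → Dim B b → Dim (A ⊓ B) i →
            ¬ ¬ ∃ λ s → Dim (A ⊕ B) s × s ℕ.+ i ≡ a ℕ.+ b
  modular {A} {B} {a} {b} {i} dA dB dI =
    climb (a ℕ.∸ i) (A ⊓ B) dI proj₁ id
      (Dim-resp {B} {(A ⊓ B) ⊕ B} (⊕-inʳ (A ⊓ B) B) (⊕-⊆ (A ⊓ B) B B proj₂ id) dB)
      (ℕₚ.+-comm b i) (ℕₚ.m∸n+n≡m (Dim-≤ proj₁ dI dA))
    where
    climb : ∀ fuel C {j s} → Dim C j → C ⊆ A → A ⊓ B ⊆ C → Dim (C ⊕ B) s → s ℕ.+ i ≡ j ℕ.+ b →
            fuel ℕ.+ j ≡ a → ¬ ¬ ∃ λ s → Dim (A ⊕ B) s × s ℕ.+ i ≡ a ℕ.+ b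
    climb zero C {j} {s} dC C⊆A I⊆C dCB eq ≡.refl = return
      (s , Dim-resp (⊕-⊆ C B (A ⊕ B) (λ x∈ → ⊕-inˡ A B (C⊆A x∈)) (⊕-inʳ A B))
                    (⊕-⊆ A B (C ⊕ B) (λ x∈ → ⊕-inˡ C B (Dim-⊇ C⊆A dC dA ℕₚ.≤-refl x∈)) (⊕-inʳ C B)) dCB , eq)
    climb (suc fuel) C {j} {s} dC C⊆A I⊆C dCB eq fj≡a = do
      x , x∈A , x∉C ← missing dC dA (ℕₚ.m+n≤o⇒n≤o fuel (ℕₚ.≤-reflexive (≡.trans (ℕₚ.+-suc fuel j) fj≡a)))
      -- If x = v + w with v in C and w in B, then w = x - v is in A ∩ B, hence in C, and so is x.
      let x∉CB : x ∉ C ⊕ B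
          x∉CB = λ (v , w , v∈ , w∈ , x≈v+w) → x∉C (resp C (sym x≈v+w) (+-mem C v∈
            (I⊆C (resp A (x≈y+z⇒x-y≈z x≈v+w) (minus-mem A x∈A (C⊆A v∈)) , w∈))))
          C′ = C ⊕ line x
          C⊆C′ : C ⊆ C′
          C⊆C′ = ⊕-inˡ C (line x)
          CB⊆ : C ⊕ B ⊆ C′ ⊕ B
          CB⊆ = ⊕-⊆ C B (C′ ⊕ B) (λ y∈ → ⊕-inˡ C′ B (C⊆C′ y∈)) (⊕-inʳ C′ B)
          U = (C ⊕ B) ⊕ line x
      climb fuel C′ (Dim-adjoin x∉C dC) (⊕-⊆ C (line x) A C⊆A (line-⊆ A x∈A)) (λ y∈ → C⊆C′ (I⊆C y∈))
        (Dim-resp {U} {C′ ⊕ B}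
          (⊕-⊆ (C ⊕ B) (line x) (C′ ⊕ B) CB⊆ (λ y∈ → ⊕-inˡ C′ B (⊕-inʳ C (line x) y∈)))
          (⊕-⊆ C′ B U (⊕-⊆ C (line x) U (λ y∈ → ⊕-inˡ (C ⊕ B) (line x) (⊕-inˡ C B y∈)) (⊕-inʳ (C ⊕ B) (line x)))
                 (λ y∈ → ⊕-inˡ (C ⊕ B) (line x) (⊕-inʳ C B y∈)))
          (Dim-adjoin x∉CB dCB))
        (≡.cong suc eq) (≡.trans (ℕₚ.+-suc fuel j) fj≡a)

  basis≉0 : ∀ {V d} (dV : Dim V d) i → basis dV i ≉ 0#
  basis≉0 dV = Ind-≉0 (independent dV)

  -- Independent pairs and their ratios

  Ind₂ : Carrier → Carrier → Set (c ⊔ ℓ)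
  Ind₂ u v = ∀ {a b} → InF a → InF b → a * u + b * v ≈ 0# → a ≈ 0# × b ≈ 0#

  Ind⇒Ind₂ : ∀ {n} {w : Fin (suc (suc n)) → Carrier} → Ind w → Ind₂ (w zero) (w (suc zero))
  Ind⇒Ind₂ {w = w} ind {a} {b} aF bF eq = k≈0 zero , k≈0 (suc zero)
    where
    k : Fin _ → Carrier
    k = a ∷ b ∷ λ _ → 0#
    k≈0 : ∀ i → k i ≈ 0#
    k≈0 = trivial ind k (λ { zero → aF ; (suc zero) → bF ; (suc (suc _)) → 0∈F })
      (trans (+-congˡ (trans (+-congˡ (comb-zero (λ i → w (suc (suc i))) (λ _ → refl))) (+-identityʳ _))) eq)

  Ind₂⇒Ind : ∀ {u v} → Ind₂ u v → Ind (u ∷ v ∷ [])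
  Ind₂⇒Ind ind₂ = mkInd λ k kF eq →
    let k₀≈0 , k₁≈0 = ind₂ (kF zero) (kF (suc zero)) (trans (+-congˡ (sym (+-identityʳ _))) eq)
    in λ { zero → k₀≈0 ; (suc zero) → k₁≈0 }

  Ind₂-sym : ∀ {u v} → Ind₂ u v → Ind₂ v u
  Ind₂-sym ind₂ aF bF eq = let b≈0 , a≈0 = ind₂ bF aF (trans (+-comm _ _) eq) in a≈0 , b≈0

  Ind₂-scale : ∀ {u v y} → y ≉ 0# → Ind₂ u v → Ind₂ (y * u) (y * v)
  Ind₂-scale {u} {v} {y} y≉0 ind₂ {a} {b} aF bF eq = ind₂ aF bF (x*y≈0⇒y≈0 y≉0
    (trans (solve 5 (λ y a u b v → y :* (a :* u :+ b :* v) := a :* (y :* u) :+ b :* (y :* v)) refl y a u b v) eq))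

  Ind₂-≉0ˡ : ∀ {u v} → Ind₂ u v → u ≉ 0#
  Ind₂-≉0ˡ ind₂ = Ind-≉0 (Ind₂⇒Ind ind₂) zero

  -- For r in F, ru - v = 0 would be a relation with coefficient -1 at v. Elements outside F are
  -- always obtained in this way.
  ratio : ∀ {u v} → Ind₂ u v → ∃ λ r → u * r ≈ v × ¬ InF r
  ratio {u} {v} ind₂ with u⁻¹ , inv ← inverse (Ind₂-≉0ˡ ind₂) = r , ur≈v , λ rF →
      contradiction (trans (sym (-‿involutive 1#)) (trans (-‿cong (proj₂ (ind₂ rF -1∈F (begin
        r * u + - 1# * v  ≈⟨ +-cong (trans (*-comm r u) ur≈v) (-1*x≈-x v) ⟩
        v - v             ≈⟨ -‿inverseʳ v ⟩
        0#                ∎)))) -0#≈0#)) 1≉0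
    where
    r = u⁻¹ * v
    ur≈v : u * r ≈ v
    ur≈v = trans (sym (*-assoc u u⁻¹ v)) (trans (*-congʳ inv) (*-identityˡ v))

-- Here x and y are the dimensions of two critical spaces, p and p′ those of their covers, n that of
-- T; s, i and r, k belong to the sums and intersections. If the sum obeys the lower bound of
-- `dim-product`, the intersection obeys the upper bound that makes it critical, and the same holds
-- with sum and intersection exchanged. Successors avoid subtracting 1.
inclusion-exclusion-≤ : ∀ {s i x y r k p p′ n} → s ℕ.+ i ≡ x ℕ.+ y → r ℕ.+ k ≡ p ℕ.+ p′ →
  suc p ≤ x ℕ.+ n → suc p′ ≤ y ℕ.+ n → s ℕ.+ n ≤ suc r → suc k ≤ i ℕ.+ n
inclusion-exclusion-≤ {s} {i} {x} {y} {r} {k} {p} {p′} {n} si rk p≤ p′≤ sn =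
  ℕₚ.+-cancelʳ-≤ (suc r) (suc k) (i ℕ.+ n) (begin
    suc k ℕ.+ suc r              ≡⟨ reorder k r ⟩
    suc (suc (r ℕ.+ k))          ≡⟨ ≡.cong (λ z → suc (suc z)) rk ⟩
    suc (suc (p ℕ.+ p′))         ≡⟨ ℕₚ.+-suc (suc p) p′ ⟨
    suc p ℕ.+ suc p′             ≤⟨ ℕₚ.+-mono-≤ p≤ p′≤ ⟩
    (x ℕ.+ n) ℕ.+ (y ℕ.+ n)      ≡⟨ shuffle x n y ⟩
    (x ℕ.+ y) ℕ.+ (n ℕ.+ n)      ≡⟨ ≡.cong (ℕ._+ (n ℕ.+ n)) si ⟨
    (s ℕ.+ i) ℕ.+ (n ℕ.+ n)      ≡⟨ shuffle′ s i n ⟩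
    (i ℕ.+ n) ℕ.+ (s ℕ.+ n)      ≤⟨ ℕₚ.+-monoʳ-≤ (i ℕ.+ n) sn ⟩
    (i ℕ.+ n) ℕ.+ suc r          ∎)
  where
  open ℕₚ.≤-Reasoning
  reorder : ∀ k r → suc k ℕ.+ suc r ≡ suc (suc (r ℕ.+ k))
  reorder k r = ≡.cong suc (≡.trans (ℕₚ.+-suc k r) (≡.cong suc (ℕₚ.+-comm k r)))
  shuffle : ∀ x n y → (x ℕ.+ n) ℕ.+ (y ℕ.+ n) ≡ (x ℕ.+ y) ℕ.+ (n ℕ.+ n)
  shuffle = solve-∀
  shuffle′ : ∀ s i n → (s ℕ.+ i) ℕ.+ (n ℕ.+ n) ≡ (i ℕ.+ n) ℕ.+ (s ℕ.+ n)
  shuffle′ = solve-∀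

-- The lower bound for the dimension of a product

module ProductSpaces {c ℓ} (L : CommutativeRing c ℓ) (isField : FieldTheory.IsField L)
  (q : ℕ) (ι : Fin q → CommutativeRing.Carrier L)
  (isSubfield : FieldTheory.IsFiniteSubfield L q ι)
  (algebraic⇒F : ∀ x → FieldTheory.Over.Algebraic L q ι x → FieldTheory.Over.InF L q ι x) where

  open LinearAlgebra L isField q ι isSubfield public
  open CommutativeRing L hiding (zero)
  open FieldTheory L
  open Over q ι
  open import Algebra.Properties.Semiring.Exp semiring using (_^_)
  open import Algebra.Solver.Ring.NaturalCoefficients.Default commutativeSemiring
    using (solve; _:=_; _:+_; _:*_)
  open import Relation.Binary.Reasoning.Setoid setoid

  -- A relation among n + 1 vectors in a span of n, divided by `v`, is a polynomial equation for
  -- `a`.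
  powers⇒F : ∀ {n a v} {w : Fin n → Carrier} → v ≉ 0# →
             (∀ (i : Fin (suc n)) → v * a ^ toℕ i ∈ span w) → InF a
  powers⇒F {n} {a} {v} v≉0 in-span
    with k , kF , eq , i , ki≉0 ← dependent {v = λ i → v * a ^ toℕ i} (ℕₚ.n<1+n n) in-span =
    algebraic⇒F a (n , (λ j → proj₁ (kF j)) , (i , λ z → ki≉0 (trans (proj₂ (kF i)) z)) ,
      trans (comb-cong {w = λ j → a ^ toℕ j} (λ j → sym (proj₂ (kF j))))
        (x*y≈0⇒y≈0 v≉0 (trans (comb-scaleʳ v k (λ j → a ^ toℕ j)) eq)))

  stable⇒F : ∀ {V d a v} → Dim V d → v ∈ V → v ≉ 0# → (∀ {x} → x ∈ V → ¬ ¬ (a * x ∈ V)) → ¬ ¬ InF a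
  stable⇒F {V} {d} {a} {v} dV v∈ v≉0 stable = do
    all ← ¬¬-choice {n = suc d} (λ i → power∈ (toℕ i))
    return (powers⇒F v≉0 (λ i → spanning dV (all i)))
    where
    power∈ : ∀ i → ¬ ¬ (v * a ^ i ∈ V)
    power∈ zero = return (resp V (sym (*-identityʳ v)) v∈)
    power∈ (suc i) = do
      p ← power∈ i
      r ← stable p
      return (resp V (solve 3 (λ a v s → a :* (v :* s) := v :* (a :* s)) refl a v (a ^ i)) r)

  -- Contrapositive of `stable⇒F`; it makes V ∩ a⁻¹V smaller than V and V + aV larger.
  escapes : ∀ {V d a v} → Dim V d → v ∈ V → v ≉ 0# → ¬ InF a → ¬ ¬ ∃ λ x → x ∈ V × a * x ∉ V
  escapes dV v∈ v≉0 a∉F none = stable⇒F dV v∈ v≉0 (λ x∈ ax∉ → none (_ , x∈ , ax∉)) a∉F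

  -- Expresses AB ⊆ P elementwise, so that P stands in for the product space AB.
  Covers : Subspace → Subspace → Subspace → Set _
  Covers A B P = ∀ {x y} → x ∈ A → y ∈ B → x * y ∈ P

  -- For y with B′ = {x ∈ B | yx ∈ A} neither 0 nor B, the pair (A + yB , B′) has the same
  -- total dimension as (A , B), and its products still lie in P.
  dim-product : ∀ {A B P a b p} → Dim A a → Dim B b → Dim P p → 1 ≤ a → 1 ≤ b →
                Covers A B P → a ℕ.+ b ≤ suc p
  dim-product dA dB dP 1≤a 1≤b cov = transform _ ℕₚ.≤-refl dA dB dP 1≤a 1≤b cov
    where
    transform : ∀ fuel {A B P a b p} → b ≤ fuel → Dim A a → Dim B b → Dim P p → 1 ≤ a → 1 ≤ b →
                Covers A B P → a ℕ.+ b ≤ suc p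
    -- When B is a line, multiplication by its generator embeds A into P.
    transform fuel {A} {B} {P} {a} {suc zero} {p} _ dA dB dP _ _ cov =
      ≡.subst (_≤ suc p) (ℕₚ.+-comm 1 a)
        (s≤s (Dim-≤ (λ (v , v∈ , eq) → resp P (trans (*-comm v b₀) (sym eq)) (cov v∈ (contained dB zero)))
          (Dim-∙ (basis≉0 dB zero) dA) dP))
      where
      b₀ = basis dB zero
    transform (suc fuel) {A} {B} {P} {suc a′} {suc (suc b″)} {p} (s≤s b≤fuel) dA dB dP 1≤a 1≤b cov =
      -- The goal is an inequality of natural numbers, hence decidable, so the bound itself carries
      -- no double negation.
      decidable-stable (_ ℕₚ.≤? _) (do
        yes (y , y≉0 , (β , β∈ , β≉0 , yβ∈A) , (x , x∈ , yx∉A)) ← em Splitting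
          where no unsplit → stuck unsplit
        let B′ = B ⊓ colon A y
            dyB = Dim-∙ y≉0 dB
        b′ , dB′ ← Dim-exists {B′} proj₁ dB
        let dI = Dim-resp {y ∙ B′} {A ⊓ y ∙ B}
                   (λ (v , (v∈B , yv∈A) , eq) → resp A (sym eq) yv∈A , v , v∈B , eq)
                   (λ (z∈A , v , v∈B , eq) → v , (v∈B , resp A eq z∈A) , eq)
                   (Dim-∙ y≉0 dB′)
        s , dA′ , s+b′ ← modular dA dyB dI
        let b′<b = ℕₚ.≰⇒> λ b≤b′ → yx∉A (proj₂ (Dim-⊇ proj₁ dB′ dB b≤b′ x∈))
            s≥1 = ℕₚ.≤-trans 1≤a (Dim-≤ (⊕-inˡ A (y ∙ B)) dA dA′)
            cov′ : Covers (A ⊕ y ∙ B) B′ P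
            cov′ = λ { {z} {w} (v , u , v∈ , (β , β∈ , u≈yβ) , eq) (w∈B , yw∈A) →
              resp P (sym (trans (*-congʳ (trans eq (+-congˡ u≈yβ)))
                (solve 4 (λ v y β w → (v :+ y :* β) :* w := v :* w :+ y :* w :* β) refl v y β w)))
                (+-mem P (cov v∈ w∈B) (cov yw∈A β∈)) }
        return (≡.subst (_≤ suc p) s+b′
          (transform fuel (ℕₚ.≤-trans (ℕₚ.≤-pred b′<b) b≤fuel) dA′ dB′ dP s≥1
            (positive (β∈ , yβ∈A) β≉0 dB′) cov′)))
      where
      Splitting : Set _
      Splitting = ∃ λ y → y ≉ 0# × (∃ λ β → β ∈ B × β ≉ 0# × y * β ∈ A) × (∃ λ x → x ∈ B × y * x ∉ A)
      b₀ = basis dB zero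
      b₁ = basis dB (suc zero)
      -- For x in A, the multiplier y = x/b₀ sends b₀ into A. If no y splits B, it sends b₁ into A
      -- as well, and yb₁ = rx for r = b₁/b₀. So A is stable under r, which is outside F.
      stuck : ¬ Splitting → ¬ ¬ (suc a′ ℕ.+ suc (suc b″) ≤ suc p)
      stuck unsplit with r , b₀r≈b₁ , r∉F ← ratio (Ind⇒Ind₂ (independent dB)) = λ _ →
        stable⇒F dA (contained dA zero) (basis≉0 dA zero) (closed r b₀r≈b₁) r∉F
        where
        closed : ∀ r → b₀ * r ≈ b₁ → ∀ {x} → x ∈ A → ¬ ¬ (r * x ∈ A)
        closed r b₀r≈b₁ {x} x∈ rx∉ with b₀⁻¹ , inv ← inverse (basis≉0 dB zero) =
          unsplit (x * b₀⁻¹ , y≉0 ,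
            (b₀ , contained dB zero , basis≉0 dB zero , resp A (sym yb₀≈x) x∈) ,
            (b₁ , contained dB (suc zero) , λ m → rx∉ (resp A yb₁≈rx m)))
          where
          yb₀≈x : x * b₀⁻¹ * b₀ ≈ x
          yb₀≈x = trans (*-assoc x b₀⁻¹ b₀) (trans (*-congˡ (trans (*-comm b₀⁻¹ b₀) inv)) (*-identityʳ x))
          yb₁≈rx : x * b₀⁻¹ * b₁ ≈ r * x
          yb₁≈rx = begin
            x * b₀⁻¹ * b₁        ≈⟨ *-congˡ b₀r≈b₁ ⟨
            x * b₀⁻¹ * (b₀ * r)
              ≈⟨ solve 4 (λ x i b₀ r → x :* i :* (b₀ :* r) := (x :* i :* b₀) :* r) refl x b₀⁻¹ b₀ r ⟩
            x * b₀⁻¹ * b₀ * r    ≈⟨ *-congʳ yb₀≈x ⟩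
            x * r                ≈⟨ *-comm x r ⟩
            r * x                ∎
          y≉0 : x * b₀⁻¹ ≉ 0#
          y≉0 z = rx∉ (resp A (trans (sym (trans (*-congʳ z) (zeroˡ b₁))) yb₁≈rx) (0-mem A))

-- Geometric progressions and critical spaces

module CriticalPairs {c ℓ} (L : CommutativeRing c ℓ) (isField : FieldTheory.IsField L)
  (q : ℕ) (ι : Fin q → CommutativeRing.Carrier L)
  (isSubfield : FieldTheory.IsFiniteSubfield L q ι)
  (algebraic⇒F : ∀ x → FieldTheory.Over.Algebraic L q ι x → FieldTheory.Over.InF L q ι x) where

  open ProductSpaces L isField q ι isSubfield algebraic⇒F public
  open CommutativeRing L hiding (zero)
  open FieldTheory L
  open Over q ι
  open import Algebra.Properties.Semiring.Exp semiring using (_^_)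
  open import Algebra.Solver.Ring.NaturalCoefficients.Default commutativeSemiring
    using (solve; _:=_; _:+_; _:*_)

  -- Induction on the dimension. V′ = V ∩ a⁻¹V satisfies aV′ = V ∩ aV, so the bound on V + aV gives
  -- it codimension at most 1, and exactly 1 because a is outside F. As V′ + aV′ ⊆ V, the hypothesis
  -- passes to V′; a progression in V′ followed by a times its last term lies in V.
  shift-progression : ∀ {V a} n → Dim V (suc n) → ¬ InF a →
    (∃ λ s → Dim (V ⊕ a ∙ V) s × s ≤ suc (suc n)) →
    ¬ ¬ ∃ λ g → g ≉ 0# × ∀ i → i ≤ n → g * a ^ i ∈ V
  shift-progression {V} zero dV a∉F _ = return
    (basis dV zero , basis≉0 dV zero , λ { zero z≤n → resp V (sym (*-identityʳ _)) (contained dV zero) })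
  shift-progression {V} {a} (suc n) dV a∉F (s , dS , s≤) = do
    let V′ = V ⊓ colon V a
        a≉0 = λ a≈0 → a∉F (F-resp (sym a≈0) 0∈F)
    d , dV′ ← Dim-exists {V′} proj₁ dV
    let dI = Dim-resp {a ∙ V′} {V ⊓ a ∙ V}
               (λ (v , (v∈ , av∈) , eq) → resp V (sym eq) av∈ , v , v∈ , eq)
               (λ (x∈ , v , v∈ , eq) → v , (v∈ , resp V eq x∈) , eq)
               (Dim-∙ a≉0 dV′)
    s′ , dS′ , eq ← modular dV (Dim-∙ a≉0 dV) dI
    x , x∈ , ax∉ ← escapes dV (contained dV zero) (basis≉0 dV zero) a∉F
    let d≤ : d ≤ suc n
        d≤ = ℕₚ.≤-pred (ℕₚ.≰⇒> λ n+2≤d → ax∉ (proj₂ (Dim-⊇ proj₁ dV′ dV n+2≤d x∈)))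
        ≤d : suc n ≤ d
        ≤d = ℕₚ.+-cancelˡ-≤ (suc (suc (suc n))) (suc n) d
               (ℕₚ.≤-trans (ℕₚ.≤-reflexive (≡.trans (≡.sym (ℕₚ.+-suc (suc (suc n)) (suc n))) (≡.sym eq)))
                 (ℕₚ.+-monoˡ-≤ d (ℕₚ.≤-trans (ℕₚ.≤-reflexive (Dim-unique dS′ dS)) s≤)))
        V′+aV′⊆V : V′ ⊕ a ∙ V′ ⊆ V
        V′+aV′⊆V = ⊕-⊆ V′ (a ∙ V′) V proj₁ (λ (v , (_ , av∈) , eq) → resp V (sym eq) av∈)
    t , dT ← Dim-exists V′+aV′⊆V dV
    g , g≉0 , progression ← shift-progression n (≡.subst (Dim V′) (ℕₚ.≤-antisym d≤ ≤d) dV′) a∉F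
      (t , dT , Dim-≤ V′+aV′⊆V dT dV)
    return (g , g≉0 , λ
      { zero _ → proj₁ (progression zero z≤n)
      ; (suc i) (s≤s i≤n) → resp V
          (solve 3 (λ a g s → a :* (g :* s) := g :* (a :* s)) refl a g (a ^ i))
          (proj₂ (progression i i≤n)) })

  -- This is S + aS + ... + aᵏS, built so that each step is a single shift whose effect on the
  -- dimension can be bounded.
  shifts : Carrier → Subspace → ℕ → Subspace
  shifts a S zero = S
  shifts a S (suc k) = shifts a S k ⊕ a ∙ shifts a S k

  shifts-cover : ∀ {S P a} k h → (∀ {x} i → i ≤ k → x ∈ S → x * (h * a ^ i) ∈ P) →
                 ∀ {x} → x ∈ shifts a S k → x * h ∈ P
  shifts-cover {P = P} zero h cov x∈ = resp P (*-congˡ (*-identityʳ h)) (cov zero z≤n x∈)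
  shifts-cover {S} {P} {a} (suc k) h cov (v , y , v∈ , (w , w∈ , y≈aw) , x≈v+y) =
    resp P (sym (trans (*-congʳ (trans x≈v+y (+-congˡ y≈aw)))
             (solve 4 (λ v a w h → (v :+ a :* w) :* h := v :* h :+ w :* (h :* a)) refl v a w h)))
      (+-mem P (shifts-cover {S} {P} k h (λ i i≤k → cov i (ℕₚ.m≤n⇒m≤1+n i≤k)) v∈)
               (shifts-cover {S} {P} k (h * a) (λ {x} i i≤k x∈ → resp P
                  (solve 4 (λ x h a s → x :* (h :* (a :* s)) := x :* (h :* a :* s)) refl x h a (a ^ i))
                  (cov (suc i) (s≤s i≤k) x∈)) w∈))

  -- No space reached is stable under a, so each shift after the first adds at least one dimension.
  shifts-grow : ∀ {S a d v} → ¬ InF a → v ≉ 0# → v ∈ S → Dim (shifts a S 1) d →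
                ∀ k → ¬ ¬ ∃ λ d′ → Dim (shifts a S (suc k)) d′ × d ℕ.+ k ≤ d′
  shifts-grow {d = d} a∉F v≉0 v∈ dS zero = return (d , dS , ℕₚ.≤-reflexive (ℕₚ.+-identityʳ d))
  shifts-grow {S} {a} {d} {v} a∉F v≉0 v∈ dS (suc k) = do
    e , dE , d+k≤e ← shifts-grow a∉F v≉0 v∈ dS k
    let E = shifts a S (suc k)
        a≉0 = λ a≈0 → a∉F (F-resp (sym a≈0) 0∈F)
    i , dI ← Dim-exists {E ⊓ a ∙ E} proj₁ dE
    s , dS′ , _ ← modular dE (Dim-∙ a≉0 dE) dI
    x , x∈ , ax∉ ← escapes dE (inside (suc k)) v≉0 a∉F
    let e<s = ℕₚ.≰⇒> λ s≤e → ax∉ (Dim-⊇ (⊕-inˡ E (a ∙ E)) dE dS′ s≤e (⊕-inʳ E (a ∙ E) (x , x∈ , refl)))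
    return (s , dS′ , ℕₚ.≤-trans (ℕₚ.≤-reflexive (ℕₚ.+-suc d k)) (ℕₚ.≤-trans (s≤s d+k≤e) e<s))
    where
    inside : ∀ k → v ∈ shifts a S k
    inside zero = v∈
    inside (suc k) = ⊕-inˡ (shifts a S k) (a ∙ shifts a S k) (inside k)

  Progression : Subspace → ℕ → Carrier → Set _
  Progression V n a = ∃ λ g → g ≉ 0# × ∀ i → i < n → g * a ^ i ∈ V

  module _ (T : Subspace) (n : ℕ) (dT : Dim T (suc n)) where

    -- The cover contains XT, and only the upper bound dim X + dim T - 1 = d + n is recorded: for
    -- nonzero X, `dim-product` supplies the opposite inequality.
    record Critical (X : Subspace) (d : ℕ) : Set (lsuc (c ⊔ ℓ)) where
      constructor mkCritical
      field
        dim         : Dim X d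
        cover       : Subspace
        {coverDim}  : ℕ
        cover-dim   : Dim cover coverDim
        covers      : Covers X T cover
        coverDim-≤  : coverDim ≤ d ℕ.+ n

    open Critical public

    critical-∙ : ∀ {X d y} → y ≉ 0# → Critical X d → Critical (y ∙ X) d
    critical-∙ {y = y} y≉0 (mkCritical dX P dP cov p≤) =
      mkCritical (Dim-∙ y≉0 dX) (y ∙ P) (Dim-∙ y≉0 dP)
      (λ { {y = t} (x , x∈ , eq) t∈ → x * t , cov x∈ t∈ , trans (*-congʳ eq) (*-assoc y x t) }) p≤

    -- P ∩ Q covers X ∩ Y and P + Q covers X + Y. By the modular law the two upper bounds add up to
    -- a total that `dim-product` leaves no room to redistribute; the common element z makes that
    -- bound applicable to X ∩ Y.
    critical-⊓⊕ : ∀ {X Y d e z} → z ∈ X → z ∈ Y → z ≉ 0# → Critical X d → Critical Y e →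
                  ¬ ¬ ∃ λ i → ∃ λ s → Critical (X ⊓ Y) i × Critical (X ⊕ Y) s × s ℕ.+ i ≡ d ℕ.+ e
    critical-⊓⊕ {X} {Y} {d} {e} z∈X z∈Y z≉0 (mkCritical dX P {p} dP covP p≤) (mkCritical dY Q {r} dQ covQ r≤) = do
      i , dI ← Dim-exists {X ⊓ Y} proj₁ dX
      s , dS , s+i ← modular dX dY dI
      k , dK ← Dim-exists {P ⊓ Q} proj₁ dP
      l , dM , l+k ← modular dP dQ dK
      let cov⊓ : Covers (X ⊓ Y) T (P ⊓ Q)
          cov⊓ = λ (x∈X , x∈Y) t∈ → covP x∈X t∈ , covQ x∈Y t∈
          cov⊕ : Covers (X ⊕ Y) T (P ⊕ Q)
          cov⊕ = λ { {y = t} (x , y , x∈ , y∈ , eq) t∈ →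
            x * t , y * t , covP x∈ t∈ , covQ y∈ t∈ , trans (*-congʳ eq) (distribʳ t x y) }
          s≥ = dim-product dS dT dM (positive (⊕-inˡ X Y z∈X) z≉0 dS) (s≤s z≤n) cov⊕
          i≥ = dim-product dI dT dK (positive (z∈X , z∈Y) z≉0 dI) (s≤s z≤n) cov⊓
          p≤′ = ℕₚ.≤-trans (s≤s p≤) (ℕₚ.≤-reflexive (≡.sym (ℕₚ.+-suc d n)))
          r≤′ = ℕₚ.≤-trans (s≤s r≤) (ℕₚ.≤-reflexive (≡.sym (ℕₚ.+-suc e n)))
          k≤ = inclusion-exclusion-≤ {s} {i} {d} {e} {l} {k} {p} {r} s+i l+k p≤′ r≤′ s≥
          l≤ = inclusion-exclusion-≤ {i} {s} {d} {e} {k} {l} {p} {r}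
                 (≡.trans (ℕₚ.+-comm i s) s+i) (≡.trans (ℕₚ.+-comm k l) l+k) p≤′ r≤′ i≥
      return (i , s ,
        mkCritical dI (P ⊓ Q) dK cov⊓ (ℕₚ.≤-pred (ℕₚ.≤-trans k≤ (ℕₚ.≤-reflexive (ℕₚ.+-suc i n)))) ,
        mkCritical dS (P ⊕ Q) dM cov⊕ (ℕₚ.≤-pred (ℕₚ.≤-trans l≤ (ℕₚ.≤-reflexive (ℕₚ.+-suc s n)))) ,
        s+i)

    module Atom {X d} (critX : Critical X d) (minimal : ∀ {Y e} → Critical Y e → 2 ≤ e → d ≤ e) where

      dX = dim critX

      -- Z ∩ yX is critical and contains the independent pair u, v; by minimality its dimension is
      -- that of yX.
      atom-⊆ : ∀ {Z e y u v} → Critical Z e → y ≉ 0# → Ind₂ u v →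
               u ∈ Z → v ∈ Z → u ∈ y ∙ X → v ∈ y ∙ X → ¬ ¬ (∀ x → x ∈ y ∙ X → x ∈ Z)
      atom-⊆ {Z} {y = y} {u} {v} critZ y≉0 ind₂ u∈Z v∈Z u∈yX v∈yX = do
        i , _ , critI , _ ← critical-⊓⊕ {Z} {y ∙ X} u∈Z u∈yX (Ind₂-≉0ˡ ind₂) critZ (critical-∙ {X} y≉0 critX)
        let dI = dim critI
            2≤i = Ind-≤-Dim (Ind₂⇒Ind ind₂)
              (λ { zero → u∈Z , u∈yX ; (suc zero) → v∈Z , v∈yX }) dI
        return (λ x x∈ → proj₁ (Dim-⊇ {Z ⊓ y ∙ X} proj₂ dI (Dim-∙ y≉0 dX) (minimal {Z ⊓ y ∙ X} critI 2≤i) x∈))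

      -- The sum wX + zX is critical and meets every yX in the independent elements yw and yz.
      atom-products : ∀ {w z} → w ∈ X → z ∈ X → Ind₂ w z → ¬ ¬ (∀ x y → x ∈ X → y ∈ X → x * y ∈ w ∙ X ⊕ z ∙ X)
      atom-products {w} {z} w∈ z∈ ind₂ = do
        let w≉0 = Ind₂-≉0ˡ ind₂
            z≉0 = Ind₂-≉0ˡ (Ind₂-sym ind₂)
            W = w ∙ X ⊕ z ∙ X
            yw∈ : ∀ {y} → y ∈ X → y * w ∈ W
            yw∈ = λ {y} y∈ → ⊕-inˡ (w ∙ X) (z ∙ X) (y , y∈ , *-comm y w)
            yz∈ : ∀ {y} → y ∈ X → y * z ∈ W
            yz∈ = λ {y} y∈ → ⊕-inʳ (w ∙ X) (z ∙ X) (y , y∈ , *-comm y z)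
        _ , _ , _ , critW , _ ← critical-⊓⊕ {w ∙ X} {z ∙ X} {z = w * z} (z , z∈ , refl) (w , w∈ , *-comm w z)
          (*-≉0 w≉0 z≉0) (critical-∙ {X} w≉0 critX) (critical-∙ {X} z≉0 critX)
        -- Only translates by basis vectors of X are treated, so that the choice is finite;
        -- linearity gives the others.
        rows ← ¬¬-choice (λ i → atom-⊆ {W} critW (basis≉0 dX i) (Ind₂-scale (basis≉0 dX i) ind₂)
          (yw∈ (contained dX i)) (yz∈ (contained dX i)) (w , w∈ , refl) (z , z∈ , refl))
        return λ x y x∈ y∈ → resp W (*-comm y x)
          (span-⊆ (colon W y) (λ i → resp W (*-comm (basis dX i) y) (rows i (basis dX i * y) (y , y∈ , refl)))
            (spanning dX x∈))

    -- With X spanned by x₀ and x₀a, the space x₀(T + aT) lies in the cover, of dimension at most n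
    -- + 2. This is the bound that `shift-progression` requires of T.
    critical-plane⇒ratio : ∀ {X} → Critical X 2 → ¬ ¬ ∃ λ a → ¬ InF a × Progression T (suc n) a
    critical-plane⇒ratio {X} (mkCritical dX P {p} dP cov p≤) with a , x₀a≈x₁ , a∉F ← ratio (Ind⇒Ind₂ (independent dX)) = do
      let x₀ = basis dX zero
          x₀≉0 = basis≉0 dX zero
          a≉0 = λ a≈0 → a∉F (F-resp (sym a≈0) 0∈F)
      i , dI ← Dim-exists {T ⊓ a ∙ T} proj₁ dT
      s , dS , _ ← modular dT (Dim-∙ a≉0 dT) dI
      let inside : x₀ ∙ (T ⊕ a ∙ T) ⊆ P
          inside = λ { (x , (t , u , t∈ , (t′ , t′∈ , u≈at′) , x≈t+u) , eq) → resp P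
            (sym (trans eq (trans (*-congˡ (trans x≈t+u (+-congˡ u≈at′)))
              (trans (solve 4 (λ x₀ t a t′ → x₀ :* (t :+ a :* t′) := x₀ :* t :+ x₀ :* a :* t′) refl x₀ t a t′)
                (+-congˡ (*-congʳ x₀a≈x₁))))))
            (+-mem P (cov (contained dX zero) t∈) (cov (contained dX (suc zero)) t′∈)) }
      g , g≉0 , progression ← shift-progression n dT a∉F
        (s , dS , ℕₚ.≤-trans (Dim-≤ inside (Dim-∙ x₀≉0 dS) dP) p≤)
      return (a , a∉F , g , g≉0 , λ { i (s≤s i≤n) → progression i i≤n })

  -- T contains h, ha, ..., haⁿ⁺¹, so h(S + aS + ... + aⁿ⁺¹S) lies in P. The n shifts after the
  -- first cost at least n dimensions, which leaves at most m + 2 for S + aS.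
  transfer-progression : ∀ {S T P a m n p} → Dim S (suc m) → Progression T (suc (suc n)) a → ¬ InF a →
    Covers S T P → Dim P p → p ≤ suc m ℕ.+ suc n → ¬ ¬ Progression S (suc m) a
  transfer-progression {S} {T} {P} {a} {m} {n} {p} dS (h , h≉0 , hT) a∉F cov dP p≤ = do
    let a≉0 = λ a≈0 → a∉F (F-resp (sym a≈0) 0∈F)
    i , dI ← Dim-exists {S ⊓ a ∙ S} proj₁ dS
    s , dS₁ , _ ← modular dS (Dim-∙ a≉0 dS) dI
    d , dSₙ , s+n≤d ← shifts-grow {S} a∉F (basis≉0 dS zero) (contained dS zero) dS₁ n
    let inside : h ∙ shifts a S (suc n) ⊆ P
        inside = λ (x , x∈ , eq) → resp P (trans (*-comm x h) (sym eq))
          (shifts-cover {S} {P} (suc n) h (λ j j≤n y∈ → cov y∈ (hT j (s≤s j≤n))) x∈)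
        d≤p = Dim-≤ inside (Dim-∙ h≉0 dSₙ) dP
        s≤ = ℕₚ.+-cancelʳ-≤ n s (suc (suc m)) (ℕₚ.≤-trans s+n≤d (ℕₚ.≤-trans d≤p
          (ℕₚ.≤-trans p≤ (ℕₚ.≤-reflexive (ℕₚ.+-suc (suc m) n)))))
    g , g≉0 , progression ← shift-progression m dS a∉F (s , dS₁ , s≤)
    return (g , g≉0 , λ { i (s≤s i≤m) → progression i i≤m })

-- For dim X = d + 1, α = dim Xʲ and d + α = dim Xʲ⁺¹, the lower bounds for an intersection i and a
-- sum s already exhaust the total given by the modular law.
squeeze : ∀ {d α s i} → s ℕ.+ i ≡ (d ℕ.+ α) ℕ.+ (d ℕ.+ α) → α ≤ i → d ℕ.+ (d ℕ.+ α) ≤ s →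
          s ≡ d ℕ.+ (d ℕ.+ α) × i ≤ α
squeeze {d} {α} {s} {i} eq α≤i s≥ =
  ℕₚ.≤-antisym (ℕₚ.+-cancelʳ-≤ α s _ (ℕₚ.≤-trans (ℕₚ.+-monoʳ-≤ s α≤i) (ℕₚ.≤-reflexive total))) s≥ ,
  ℕₚ.+-cancelˡ-≤ s i α (ℕₚ.≤-trans (ℕₚ.≤-reflexive total) (ℕₚ.+-monoˡ-≤ α s≥))
  where
  rearrange : ∀ d α → (d ℕ.+ α) ℕ.+ (d ℕ.+ α) ≡ (d ℕ.+ (d ℕ.+ α)) ℕ.+ α
  rearrange = solve-∀
  total : s ℕ.+ i ≡ (d ℕ.+ (d ℕ.+ α)) ℕ.+ α
  total = ≡.trans eq (rearrange d α)

-- Exclusion of atoms of dimension at least 3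

module LargeAtoms {c ℓ} (L : CommutativeRing c ℓ) (isField : FieldTheory.IsField L)
  (q : ℕ) (ι : Fin q → CommutativeRing.Carrier L)
  (isSubfield : FieldTheory.IsFiniteSubfield L q ι)
  (algebraic⇒F : ∀ x → FieldTheory.Over.Algebraic L q ι x → FieldTheory.Over.InF L q ι x) where

  open CriticalPairs L isField q ι isSubfield algebraic⇒F public
  open CommutativeRing L hiding (zero)
  open FieldTheory L
  open Over q ι
  open import Algebra.Properties.Ring ring
  open import Algebra.Properties.Semiring.Exp semiring using (_^_; ^-congˡ)
  open import Algebra.Properties.CommutativeSemiring.Exp commutativeSemiring using (^-distrib-*)
  open import Algebra.Properties.CommutativeMonoid.Sum *-commutativeMonoid
    using () renaming (sum to product; sum-permute to product-permute; ∑-distrib-+ to product-*;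
                       sum-cong-≋ to product-cong; sum-replicate to product-replicate)
  open import Algebra.Solver.Ring.NaturalCoefficients.Default commutativeSemiring
    using (solve; _:=_; _:+_; _:*_)
  open import Relation.Binary.Reasoning.Setoid setoid

  -- The size is written `suc M` so that M counts the nonzero elements and can serve as the exponent
  -- in Fermat's theorem.
  record Enumeration (V : Subspace) (M : ℕ) : Set (c ⊔ ℓ) where
    field
      element   : Fin (suc M) → Carrier
      element∈  : ∀ i → element i ∈ V
      distinct  : ∀ {i j} → element i ≈ element j → i ≡ j
      complete  : ∀ {x} → x ∈ V → ∃ λ i → x ≈ element i

    origin : Fin (suc M)
    origin = proj₁ (complete (0-mem V))

    nonzero : Fin M → Carrier
    nonzero i = element (punchIn origin i)

    nonzero∈ : ∀ i → nonzero i ∈ V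
    nonzero∈ i = element∈ (punchIn origin i)

    nonzero≉0 : ∀ i → nonzero i ≉ 0#
    nonzero≉0 i eq = Finₚ.punchInᵢ≢i origin i (distinct (trans eq (proj₂ (complete (0-mem V)))))

    nonzero-distinct : ∀ {i j} → nonzero i ≈ nonzero j → i ≡ j
    nonzero-distinct eq = Finₚ.punchIn-injective origin _ _ (distinct eq)

    nonzero-complete : ∀ {x} → x ∈ V → x ≉ 0# → ∃ λ i → x ≈ nonzero i
    nonzero-complete {x} x∈ x≉0 with i , x≈ ← complete x∈ =
      punchOut origin≢i , trans x≈ (reflexive (≡.cong element (≡.sym (Finₚ.punchIn-punchOut origin≢i))))
      where
      origin≢i : ¬ (origin ≡ i)
      origin≢i e = x≉0 (trans x≈ (trans (reflexive (≡.cong element (≡.sym e))) (sym (proj₂ (complete (0-mem V))))))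

  enumerate : ∀ {n} {w : Fin n → Carrier} → Ind w → ∃ (Enumeration (span w))
  enumerate {n} {w} ind = positive-size (q ℕ.^ n) vector vector∈ vector-distinct vector-complete
    where
    vector : Fin (q ℕ.^ n) → Carrier
    vector i = comb (λ j → ι (Fin.finToFun i j)) w
    vector∈ : ∀ i → vector i ∈ span w
    vector∈ i = (λ j → ι (Fin.finToFun i j)) , (λ j → Fin.finToFun i j , refl) , refl
    vector-distinct : ∀ {i j} → vector i ≈ vector j → i ≡ j
    vector-distinct {i} {j} eq = finToFun-injective {n} {q} i j λ k →
      FieldTheory.IsFiniteSubfield.injective isSubfield _ _
        (Ind-unique ind (λ k → Fin.finToFun i k , refl) (λ k → Fin.finToFun j k , refl) eq k)
    vector-complete : ∀ {x} → x ∈ span w → ∃ λ i → x ≈ vector i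
    vector-complete (k , kF , eq) = Fin.funToFin (λ j → proj₁ (kF j)) , trans eq (comb-cong λ j →
      trans (proj₂ (kF j)) (reflexive (≡.cong ι (≡.sym (Finₚ.finToFun-funToFin (λ j → proj₁ (kF j)) j)))))
    positive-size : ∀ N (vec : Fin N → Carrier) → (∀ i → vec i ∈ span w) → (∀ {i j} → vec i ≈ vec j → i ≡ j) →
                    (∀ {x} → x ∈ span w → ∃ λ i → x ≈ vec i) → ∃ (Enumeration (span w))
    positive-size zero vec vec∈ dist compl = contradiction (proj₁ (compl (0-mem (span w)))) λ ()
    positive-size (suc M) vec vec∈ dist compl = M , record
      { element = vec ; element∈ = vec∈ ; distinct = dist ; complete = compl }

  -- The graded ring of the powers of X

  module Graded (X : Subspace) (e : ℕ) (dX : Dim X (suc (suc e)))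
    (products-in : ∀ {w z} → w ∈ X → z ∈ X → Ind₂ w z → ¬ ¬ (∀ x y → x ∈ X → y ∈ X → x * y ∈ w ∙ X ⊕ z ∙ X))
    (w₀ z₀ : Carrier) (w₀∈ : w₀ ∈ X) (z₀∈ : z₀ ∈ X) (ind₀ : Ind₂ w₀ z₀)
    (base : ∀ x y → x ∈ X → y ∈ X → x * y ∈ w₀ ∙ X ⊕ z₀ ∙ X) where

    -- The subspace spanned by the products of j elements of X; the pair (w₀ , z₀) serves only
    -- to define it without general products of subspaces.
    power : ℕ → Subspace
    power zero = line 1#
    power (suc zero) = X
    power (suc (suc j)) = w₀ ∙ power (suc j) ⊕ z₀ ∙ power (suc j)

    1∈power : 1# ∈ power 0
    1∈power = line-gen 1#

    power-suc : ∀ j {x f} → x ∈ X → f ∈ power j → x * f ∈ power (suc j)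
    power-suc zero {x} x∈ (Level.lift (a , aF , f≈)) = resp X
      (trans (*-comm a x) (*-congˡ (trans (sym (*-identityʳ a)) (sym f≈)))) (·-mem X aF x∈)
    power-suc (suc zero) x∈ f∈ = base _ _ x∈ f∈
    power-suc (suc (suc j)) {x} {f} x∈ (g , h , (g′ , g′∈ , g≈) , (h′ , h′∈ , h≈) , f≈) =
      w₀ * (x * g′) , z₀ * (x * h′) ,
      (x * g′ , power-suc (suc j) x∈ g′∈ , refl) , (x * h′ , power-suc (suc j) x∈ h′∈ , refl) ,
      trans (*-congˡ (trans f≈ (+-cong g≈ h≈)))
        (solve 5 (λ x w g z h → x :* (w :* g :+ z :* h) := w :* (x :* g) :+ z :* (x :* h)) refl x w₀ g′ z₀ h′)

    module _ {w z} (w∈ : w ∈ X) (z∈ : z ∈ X) where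

      sum-suc : ∀ {j y f} → y ∈ X → f ∈ w ∙ power j ⊕ z ∙ power j →
                y * f ∈ w ∙ power (suc j) ⊕ z ∙ power (suc j)
      sum-suc {j} {y} y∈ (g , h , (g′ , g′∈ , g≈) , (h′ , h′∈ , h≈) , f≈) =
        w * (y * g′) , z * (y * h′) ,
        (y * g′ , power-suc j y∈ g′∈ , refl) , (y * h′ , power-suc j y∈ h′∈ , refl) ,
        trans (*-congˡ (trans f≈ (+-cong g≈ h≈)))
          (solve 5 (λ x w g z h → x :* (w :* g :+ z :* h) := w :* (x :* g) :+ z :* (x :* h)) refl y w g′ z h′)

      -- The degree-2 inclusion propagates to all degrees, so any independent pair w, z can replace
      -- the pair `w₀`, `z₀` that defines the powers.
      covers-power : (∀ x y → x ∈ X → y ∈ X → x * y ∈ w ∙ X ⊕ z ∙ X) →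
                     ∀ j → Covers X (power (suc j)) (w ∙ power (suc j) ⊕ z ∙ power (suc j))
      covers-power cov zero x∈ f∈ = cov _ _ x∈ f∈
      covers-power cov (suc j) {x} {f} x∈ (g , h , (g′ , g′∈ , g≈) , (h′ , h′∈ , h≈) , f≈) =
        resp W (sym (trans (*-congˡ (trans f≈ (+-cong g≈ h≈)))
          (solve 5 (λ x w g z h → x :* (w :* g :+ z :* h) := w :* (x :* g) :+ z :* (x :* h)) refl x w₀ g′ z₀ h′)))
          (+-mem W (sum-suc {suc j} w₀∈ (covers-power cov j x∈ g′∈)) (sum-suc {suc j} z₀∈ (covers-power cov j x∈ h′∈)))
        where
        W = w ∙ power (suc (suc j)) ⊕ z ∙ power (suc (suc j))

    -- In closed form j(dim X - 1) + 1.
    degreeDim : ℕ → ℕ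
    degreeDim zero = 1
    degreeDim (suc j) = suc e ℕ.+ degreeDim j

    module _ {w z} (w∈ : w ∈ X) (z∈ : z ∈ X) (ind₂ : Ind₂ w z)
             (cov : ∀ x y → x ∈ X → y ∈ X → x * y ∈ w ∙ X ⊕ z ∙ X) where

      -- The intersection contains wzXʲ, and the sum, which covers X · Xʲ⁺¹, is bounded below by
      -- `dim-product`; by `squeeze` both bounds are attained. The part on the intersection says
      -- that w and z are coprime.
      sum-and-intersection : ∀ j → Dim (power j) (degreeDim j) → Dim (power (suc j)) (degreeDim (suc j)) →
        ¬ ¬ (Dim (w ∙ power (suc j) ⊕ z ∙ power (suc j)) (degreeDim (suc (suc j))) ×
             (∀ x → x ∈ w ∙ power (suc j) ⊓ z ∙ power (suc j) → x ∈ (w * z) ∙ power j))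
      sum-and-intersection j dP dP′ = do
        i , dI ← Dim-exists {A ⊓ B} proj₁ dA
        s , dS , s+i ← modular dA (Dim-∙ z≉0 dP′) dI
        return (conclude dI dS s+i)
        where
        A = w ∙ power (suc j)
        B = z ∙ power (suc j)
        w≉0 : w ≉ 0#
        w≉0 = Ind₂-≉0ˡ ind₂
        z≉0 : z ≉ 0#
        z≉0 = Ind₂-≉0ˡ (Ind₂-sym ind₂)
        dA : Dim A (degreeDim (suc j))
        dA = Dim-∙ w≉0 dP′
        dwz : Dim ((w * z) ∙ power j) (degreeDim j)
        dwz = Dim-∙ (*-≉0 w≉0 z≉0) dP
        ⊆I : (w * z) ∙ power j ⊆ A ⊓ B
        ⊆I (f , f∈ , eq) = (z * f , power-suc j z∈ f∈ , trans eq (*-assoc w z f)) ,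
          (w * f , power-suc j w∈ f∈ , trans eq (trans (*-congʳ (*-comm w z)) (*-assoc z w f)))
        dS-≥ : ∀ {s} → Dim (A ⊕ B) s → suc e ℕ.+ degreeDim (suc j) ≤ s
        dS-≥ dS = ℕₚ.≤-pred (dim-product dX dP′ dS (s≤s z≤n) (s≤s z≤n) (covers-power w∈ z∈ cov j))
        conclude : ∀ {i s} → Dim (A ⊓ B) i → Dim (A ⊕ B) s → s ℕ.+ i ≡ degreeDim (suc j) ℕ.+ degreeDim (suc j) →
          Dim (A ⊕ B) (degreeDim (suc (suc j))) × (∀ x → x ∈ A ⊓ B → x ∈ (w * z) ∙ power j)
        conclude {i} {s} dI dS s+i = ≡.subst (Dim (A ⊕ B)) (proj₁ sizes) dS , λ x x∈ → Dim-⊇ ⊆I dwz dI (proj₂ sizes) x∈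
          where
          sizes : s ≡ degreeDim (suc (suc j)) × i ≤ degreeDim j
          sizes = squeeze {suc e} {degreeDim j} s+i (Dim-≤ ⊆I dwz dI) (dS-≥ dS)

    power-dim : ∀ j → ¬ ¬ (Dim (power j) (degreeDim j) × Dim (power (suc j)) (degreeDim (suc j)))
    power-dim zero = return (Dim-line 1≉0 , ≡.subst (Dim X) (≡.sym (ℕₚ.+-comm (suc e) 1)) dX)
    power-dim (suc j) = do
      dP , dP′ ← power-dim j
      dP″ , _ ← sum-and-intersection w₀∈ z₀∈ ind₀ base j dP dP′
      return (dP′ , dP″)

    -- Divisibility in the graded ring: z has degree 1, so in degree 0 it divides nothing but 0.
    Divides : Carrier → ℕ → Carrier → Set (c ⊔ ℓ)
    Divides z zero f = Level.Lift c (f ≈ 0#)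
    Divides z (suc j) f = f ∈ z ∙ power j

    -- In positive degree wf is a common multiple of w and z, hence a multiple of wz. In degree 0, f
    -- is a scalar and wf = bz contradicts independence unless f = 0.
    cancel : ∀ {w z} → w ∈ X → z ∈ X → Ind₂ w z → ∀ j {f} → f ∈ power j →
             Divides z (suc j) (w * f) → ¬ ¬ Divides z j f
    cancel {w} {z} w∈ z∈ ind₂ zero {f} (Level.lift (a , aF , f≈)) (g , Level.lift (b , bF , g≈) , eq) =
      return (Level.lift (trans f≈ (trans (*-congʳ a≈0) (zeroˡ 1#))))
      where
      a≈0 : a ≈ 0#
      a≈0 = proj₁ (ind₂ aF (F-neg bF) (begin
        a * w + - b * z
          ≈⟨ +-congʳ (trans (*-comm a w) (*-congˡ (trans (sym (*-identityʳ a)) (sym f≈)))) ⟩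
        w * f + - b * z             ≈⟨ +-congʳ (trans eq (*-congˡ (trans g≈ (*-identityʳ b)))) ⟩
        z * b + - b * z             ≈⟨ +-cong (*-comm z b) (sym (-‿distribˡ-* b z)) ⟩
        b * z - b * z               ≈⟨ -‿inverseʳ (b * z) ⟩
        0#                          ∎))
    cancel {w} {z} w∈ z∈ ind₂ (suc j) {f} f∈ (g , g∈ , eq) = do
      cov ← products-in w∈ z∈ ind₂
      dP , dP′ ← power-dim j
      _ , ⊆wz ← sum-and-intersection w∈ z∈ ind₂ cov j dP dP′
      let h , h∈ , wf≈wzh = ⊆wz (w * f) ((f , f∈ , refl) , (g , g∈ , eq))
      return (h , h∈ , *-cancelˡ (Ind₂-≉0ˡ ind₂) (trans wf≈wzh (*-assoc w z h)))

    -- Dividing f by the first divisor lowers the degree by 1, and by `cancel` the others still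
    -- divide the quotient. One divisor is left over in degree 0, which forces the quotient to
    -- vanish.
    vanish : ∀ j {k f} (z : Fin k → Carrier) → j < k → (∀ i → z i ∈ X) →
             (∀ i i′ → ¬ (i ≡ i′) → Ind₂ (z i) (z i′)) →
             (∀ i → Divides (z i) j f) → ¬ ¬ (f ≈ 0#)
    vanish zero {suc k} z _ z∈ coprime div = return (Level.lower (div zero))
    vanish (suc j) {suc k} {f} z (s≤s j<k) z∈ coprime div = do
      let g , g∈ , f≈ = div zero
      div′ ← ¬¬-choice (λ i → cancel (z∈ zero) (z∈ (suc i)) (coprime zero (suc i) λ ()) j g∈
               (resp (z (suc i) ∙ power j) f≈ (div (suc i))))
      g≈0 ← vanish j (z ∘ suc) j<k (z∈ ∘ suc)
              (λ i i′ i≢i′ → coprime (suc i) (suc i′) (i≢i′ ∘ Finₚ.suc-injective)) div′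
      return (trans f≈ (trans (*-congˡ g≈0) (zeroʳ (z zero))))

    power-* : ∀ i {j f g} → f ∈ power i → g ∈ power j → f * g ∈ power (i ℕ.+ j)
    power-* zero {j} {f} {g} (Level.lift (a , aF , f≈)) g∈ =
      resp (power j) (*-congʳ (trans (sym (*-identityʳ a)) (sym f≈))) (·-mem (power j) aF g∈)
    power-* (suc zero) {j} f∈ g∈ = power-suc j f∈ g∈
    power-* (suc (suc i)) {j} {f} {g} (h , k , (h′ , h′∈ , h≈) , (k′ , k′∈ , k≈) , f≈) g∈ =
      resp P (sym (trans (*-congʳ (trans f≈ (+-cong h≈ k≈)))
        (solve 5 (λ w h z k g → (w :* h :+ z :* k) :* g := w :* (h :* g) :+ z :* (k :* g)) refl w₀ h′ z₀ k′ g)))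
        (+-mem P (power-suc (suc (i ℕ.+ j)) w₀∈ (power-* (suc i) h′∈ g∈))
                 (power-suc (suc (i ℕ.+ j)) z₀∈ (power-* (suc i) k′∈ g∈)))
      where
      P = power (suc (suc (i ℕ.+ j)))

    ^-power : ∀ {x} → x ∈ X → ∀ j → x ^ j ∈ power j
    ^-power x∈ zero = 1∈power
    ^-power x∈ (suc j) = power-suc j x∈ (^-power x∈ j)

    -- Unlike k + k, this grows by 2 definitionally when a factor of degree 2 is added to a product.
    double : ℕ → ℕ
    double zero = zero
    double (suc k) = suc (suc (double k))

    double≡+ : ∀ k → double k ≡ k ℕ.+ k
    double≡+ zero = ≡.refl
    double≡+ (suc k) = ≡.cong suc (≡.trans (≡.cong suc (double≡+ k)) (≡.sym (ℕₚ.+-suc k k)))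

    module _ {z} (z∈ : z ∈ X) where

      divides-resp : ∀ j {f g} → f ≈ g → Divides z j f → Divides z j g
      divides-resp zero f≈g (Level.lift f≈0) = Level.lift (trans (sym f≈g) f≈0)
      divides-resp (suc j) f≈g div = resp (z ∙ power j) f≈g div

      divides-* : ∀ j {f g} → f ∈ power 2 → Divides z j g → Divides z (suc (suc j)) (f * g)
      divides-* zero {f} f∈ (Level.lift g≈0) = 0# , 0-mem X , trans (*-congˡ g≈0) (trans (zeroʳ f) (sym (zeroʳ z)))
      divides-* (suc j) {f} f∈ (h , h∈ , g≈) = f * h , power-* 2 {j} f∈ h∈ ,
        trans (*-congˡ g≈) (solve 3 (λ f z h → f :* (z :* h) := z :* (f :* h)) refl f z h)

      product-power : ∀ {k} (A : Fin k → Carrier) → (∀ i → A i ∈ power 2) → product A ∈ power (double k)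
      product-power {zero} A A∈ = 1∈power
      product-power {suc k} A A∈ = power-* 2 {double k} (A∈ zero) (product-power (A ∘ suc) (A∈ ∘ suc))

      -- Telescoping: the difference is (A₀ - B₀)ΠA + B₀(ΠA - ΠB), where Π runs over the remaining
      -- factors.
      product-congruent : ∀ {k} (A B : Fin k → Carrier) → (∀ i → A i ∈ power 2) → (∀ i → B i ∈ power 2) →
        (∀ i → A i - B i ∈ z ∙ X) → Divides z (double k) (product A - product B)
      product-congruent {zero} A B A∈ B∈ A≡B = Level.lift (-‿inverseʳ 1#)
      product-congruent {suc k} A B A∈ B∈ A≡B with h , h∈ , eq ← A≡B zero =
        resp (z ∙ power (suc (double k))) (sym split)
          (+-mem (z ∙ power (suc (double k)))
            (h * ΠA , power-suc (double k) h∈ (product-power (A ∘ suc) (A∈ ∘ suc)) ,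
              trans (*-congʳ eq) (*-assoc z h ΠA))
            (divides-* (double k) (B∈ zero) (product-congruent (A ∘ suc) (B ∘ suc) (A∈ ∘ suc) (B∈ ∘ suc) (A≡B ∘ suc))))
        where
        ΠA = product (A ∘ suc)
        ΠB = product (B ∘ suc)
        split : A zero * ΠA - B zero * ΠB ≈ (A zero - B zero) * ΠA + B zero * (ΠA - ΠB)
        split = x≈y+z⇒x-y≈z (begin
          A zero * ΠA
            ≈⟨ *-congʳ (y+[x-y]≈x (A zero) (B zero)) ⟨
          (B zero + (A zero - B zero)) * ΠA                               ≈⟨ distribʳ ΠA (B zero) _ ⟩
          B zero * ΠA + (A zero - B zero) * ΠA
            ≈⟨ +-congʳ (*-congˡ (y+[x-y]≈x ΠA ΠB)) ⟨
          B zero * (ΠB + (ΠA - ΠB)) + (A zero - B zero) * ΠA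
            ≈⟨ solve 4 (λ b p d r → b :* (p :+ d) :+ r := b :* p :+ (r :+ b :* d))
                 refl (B zero) ΠB (ΠA - ΠB) _ ⟩
          B zero * ΠB + ((A zero - B zero) * ΠA + B zero * (ΠA - ΠB))     ∎)

      cancel-product : ∀ {k} (A : Fin k → Carrier) → (∀ i → A i ∈ X) → (∀ i → Ind₂ (A i) z) →
        ∀ j {f} → f ∈ power j → Divides z (k ℕ.+ j) (product A * f) → ¬ ¬ Divides z j f
      cancel-product {zero} A A∈ ind j {f} f∈ div = return (divides-resp j (*-identityˡ f) div)
      cancel-product {suc k} A A∈ ind j {f} f∈ div = do
        div′ ← cancel (A∈ zero) z∈ (ind zero) (k ℕ.+ j) (product-linear (A ∘ suc) (A∈ ∘ suc))
                 (divides-resp (suc (k ℕ.+ j)) (*-assoc (A zero) (product (A ∘ suc)) f) div)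
        cancel-product (A ∘ suc) (A∈ ∘ suc) (ind ∘ suc) j f∈ div′
        where
        product-linear : ∀ {k} (A : Fin k → Carrier) → (∀ i → A i ∈ X) → product A * f ∈ power (k ℕ.+ j)
        product-linear {zero} A A∈ = resp (power j) (sym (*-identityˡ f)) f∈
        product-linear {suc k} A A∈ = resp (power (suc k ℕ.+ j)) (sym (*-assoc _ _ f))
          (power-suc (k ℕ.+ j) (A∈ zero) (product-linear (A ∘ suc) (A∈ ∘ suc)))

      -- Fermat's little theorem in the field of fractions of degree 0 modulo z.
      module Fermat {H M} (H⊆X : H ⊆ X) (enumeration : Enumeration H M)
        (split : ∀ {x} → x ∈ X → x ∈ H ⊕ line z) (disjoint : ∀ {x} → x ∈ H → x ∈ line z → x ≈ 0#)
        (z≉0 : z ≉ 0#) where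

        open Enumeration enumeration

        complement-Ind₂ : ∀ {h} → h ∈ H → h ≉ 0# → Ind₂ h z
        complement-Ind₂ {h} h∈ h≉0 {a} {b} aF bF eq = a≈0 , b≈0
          where
          ah≈0 : a * h ≈ 0#
          ah≈0 = disjoint (·-mem H aF h∈) (resp (line z) (sym (+-inverseˡ-unique _ _ eq))
            (neg-mem (line z) (·-mem (line z) bF (line-gen z))))
          a≈0 : a ≈ 0#
          a≈0 = x*y≈0⇒y≈0 h≉0 (trans (*-comm h a) ah≈0)
          b≈0 : b ≈ 0#
          b≈0 = x*y≈0⇒y≈0 z≉0 (trans (*-comm z b) (trans (sym (+-identityˡ _)) (trans (+-congʳ (sym ah≈0)) eq)))

        -- Cancelling u, which is coprime to z, leaves h in the line of z, and H meets that line
        -- only in 0.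
        prime : ∀ {u h} → u ∈ H → u ≉ 0# → h ∈ H → u * h ∈ z ∙ X → ¬ ¬ (h ≈ 0#)
        prime u∈ u≉0 h∈ uh∈ = do
          g , Level.lift (a , aF , g≈) , h≈ ← cancel (H⊆X u∈) z∈ (complement-Ind₂ u∈ u≉0) 1 (H⊆X h∈) uh∈
          return (disjoint h∈ (Level.lift (a , aF ,
            trans h≈ (trans (*-comm z g) (*-congʳ (trans g≈ (*-identityʳ a)))))))

        module _ {u v} (u∈ : u ∈ H) (v∈ : v ∈ H) (u≉0 : u ≉ 0#) (v≉0 : v ≉ 0#) where

          -- This is multiplication by u/v on the residues, represented by H. Write uhᵢ = vx + zy
          -- and split x = h + az: modulo z only vh remains, and h is nonzero because z does not
          -- divide uhᵢ.
          match : (∀ x y → x ∈ X → y ∈ X → x * y ∈ v ∙ X ⊕ z ∙ X) →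
                  ∀ i → ∃ λ j → u * nonzero i - v * nonzero j ∈ z ∙ X
          match cov i with cov u (nonzero i) (H⊆X u∈) (H⊆X (nonzero∈ i))
          ... | p , r , (x , x∈ , p≈) , (y , y∈ , r≈) , eq with split x∈
          ...   | h , t , h∈ , Level.lift (a , aF , t≈) , x≈ =
            let j , h≈ = nonzero-complete h∈ h≉0
            in j , resp (z ∙ X) (+-congˡ (-‿cong (*-congˡ h≈))) difference
            where
            difference : u * nonzero i - v * h ∈ z ∙ X
            difference = a * v + y , +-mem X (·-mem X aF (H⊆X v∈)) y∈ , x≈y+z⇒x-y≈z (begin
              u * nonzero i                ≈⟨ trans eq (+-cong p≈ r≈) ⟩
              v * x + z * y                ≈⟨ +-congʳ (*-congˡ (trans x≈ (+-congˡ t≈))) ⟩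
              v * (h + a * z) + z * y
                ≈⟨ solve 5 (λ v h a z y → v :* (h :+ a :* z) :+ z :* y := v :* h :+ z :* (a :* v :+ y))
                     refl v h a z y ⟩
              v * h + z * (a * v + y)      ∎)
            h≉0 : h ≉ 0#
            h≉0 h≈0 = prime u∈ u≉0 (nonzero∈ i) (resp (z ∙ X) (begin
              u * nonzero i - v * h  ≈⟨ +-congˡ (trans (-‿cong (trans (*-congˡ h≈0) (zeroʳ v))) -0#≈0#) ⟩
              u * nonzero i + 0#     ≈⟨ +-identityʳ _ ⟩
              u * nonzero i          ∎) difference) (nonzero≉0 i)

          -- The congruences of `match` are multiplied over all nonzero elements of H. As σ permutes
          -- these, uᴹN ≡ vᴹN modulo z with N their product, and the factors of N are coprime to z.
          fermat : ¬ ¬ Divides z M (u ^ M - v ^ M)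
          fermat = do
            cov ← products-in (H⊆X v∈) z∈ (complement-Ind₂ v∈ v≉0)
            let σ : Fin M → Fin M
                σ = λ i → proj₁ (match cov i)
                σ-spec : ∀ i → u * nonzero i - v * nonzero (σ i) ∈ z ∙ X
                σ-spec = λ i → proj₂ (match cov i)
                A = λ i → u * nonzero i
                B = λ i → v * nonzero (σ i)
                N = product nonzero
                π , π≡σ = injective⇒permutation σ (σ-injective σ σ-spec)
                ΠA : product A ≈ u ^ M * N
                ΠA = trans (product-* (λ _ → u) nonzero) (*-congʳ (product-replicate M))
                ΠB : product B ≈ v ^ M * N
                ΠB = trans (product-* (λ _ → v) (nonzero ∘ σ)) (*-cong (product-replicate M)
                       (sym (trans (product-permute nonzero π)
                         (product-cong (λ i → reflexive (≡.cong nonzero (π≡σ i)))))))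
                factored : product A - product B ≈ N * (u ^ M - v ^ M)
                factored = trans (+-cong ΠA (-‿cong ΠB))
                  (trans (sym ([y-z]x≈yx-zx N (u ^ M) (v ^ M))) (*-comm _ N))
                div : Divides z (M ℕ.+ M) (N * (u ^ M - v ^ M))
                div = ≡.subst (λ k → Divides z k (N * (u ^ M - v ^ M))) (double≡+ M)
                  (divides-resp (double M) factored (product-congruent A B
                    (λ i → power-suc 1 (H⊆X u∈) (H⊆X (nonzero∈ i)))
                    (λ i → power-suc 1 (H⊆X v∈) (H⊆X (nonzero∈ (σ i)))) σ-spec))
            cancel-product nonzero (λ i → H⊆X (nonzero∈ i))
              (λ i → complement-Ind₂ (nonzero∈ i) (nonzero≉0 i)) M
              (minus-mem (power M) (^-power (H⊆X u∈) M) (^-power (H⊆X v∈) M)) div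
            where
            -- If σ takes the same value at i and j, subtracting the congruences shows that z
            -- divides u(hᵢ - hⱼ), so hᵢ = hⱼ.
            σ-injective : ∀ (σ : Fin M → Fin M) → (∀ i → u * nonzero i - v * nonzero (σ i) ∈ z ∙ X) →
                          ∀ {i j} → σ i ≡ σ j → i ≡ j
            σ-injective σ σ-spec {i} {j} σi≡σj = decidable-stable (i ≟ j) λ i≢j →
              prime u∈ u≉0 (minus-mem H (nonzero∈ i) (nonzero∈ j))
                (resp (z ∙ X) difference (minus-mem (z ∙ X) (σ-spec i) (σ-spec j)))
                (λ eq → i≢j (nonzero-distinct (x-y≈0⇒x≈y eq)))
              where
              same : v * nonzero (σ i) ≈ v * nonzero (σ j)
              same = reflexive (≡.cong (λ k → v * nonzero k) σi≡σj)
              difference : (u * nonzero i - v * nonzero (σ i)) - (u * nonzero j - v * nonzero (σ j)) ≈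
                           u * (nonzero i - nonzero j)
              difference = x≈y+z⇒x-y≈z (x≈y+z⇒x-y≈z (begin
                u * nonzero i
                  ≈⟨ *-congˡ (y+[x-y]≈x (nonzero i) (nonzero j)) ⟨
                u * (nonzero j + (nonzero i - nonzero j))                       ≈⟨ distribˡ u _ _ ⟩
                u * nonzero j + u * (nonzero i - nonzero j)
                  ≈⟨ +-congʳ (y+[x-y]≈x (u * nonzero j) (v * nonzero (σ j))) ⟨
                v * nonzero (σ j) + (u * nonzero j - v * nonzero (σ j)) + u * (nonzero i - nonzero j)
                  ≈⟨ +-assoc _ _ _ ⟩
                v * nonzero (σ j) + ((u * nonzero j - v * nonzero (σ j)) + u * (nonzero i - nonzero j))
                  ≈⟨ +-congʳ same ⟨
                v * nonzero (σ i) + ((u * nonzero j - v * nonzero (σ j)) + u * (nonzero i - nonzero j)) ∎))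

  -- Roots of unity and the divisors from a hyperplane translate

  ^-≉0 : ∀ {x} → x ≉ 0# → ∀ n → x ^ n ≉ 0#
  ^-≉0 x≉0 zero = 1≉0
  ^-≉0 x≉0 (suc n) = *-≉0 x≉0 (^-≉0 x≉0 n)

  root-of-unity⇒F : ∀ {r} n → r ^ suc n ≈ 1# → InF r
  root-of-unity⇒F {r} n r^n≈1 = powers⇒F {w = powers} 1≉0 λ i →
    resp (span powers) (sym (*-identityˡ _)) (reduce (toℕ i) (ℕₚ.≤-pred (Finₚ.toℕ<n i)))
    where
    powers : Fin (suc n) → Carrier
    powers j = r ^ toℕ j
    reduce : ∀ k → k ≤ suc n → r ^ k ∈ span powers
    reduce k k≤ with k ℕₚ.≟ suc n
    ... | yes ≡.refl = resp (span powers) (sym r^n≈1) (span-gen powers zero)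
    ... | no k≢ = resp (span powers) (reflexive (≡.cong (r ^_) (Finₚ.toℕ-fromℕ< k<)))
                    (span-gen powers (Fin.fromℕ< k<))
      where
      k< = ℕₚ.≤∧≢⇒< k≤ k≢

  -- The ratio r is an n-th root of unity. The element of `Fin n` rules out n = 0, where equality of
  -- powers says nothing.
  equal-powers⇒F : ∀ {u v r n} → Fin n → u ≉ 0# → u * r ≈ v → u ^ n ≈ v ^ n → InF r
  equal-powers⇒F {u} {v} {r} {suc n} _ u≉0 ur≈v eq = root-of-unity⇒F n (*-cancelˡ (^-≉0 u≉0 (suc n)) (begin
    u ^ suc n * r ^ suc n  ≈⟨ ^-distrib-* u r (suc n) ⟨
    (u * r) ^ suc n        ≈⟨ ^-congˡ (suc n) ur≈v ⟩
    v ^ suc n              ≈⟨ eq ⟨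
    u ^ suc n              ≈⟨ *-identityʳ _ ⟨
    u ^ suc n * 1#         ∎))

  module _ {X e b₀} {t : Fin (suc (suc e)) → Carrier} (ind : Ind (b₀ ∷ t)) (dX : Dim X (suc (suc (suc e))))
    (b₀∈ : b₀ ∈ X) (t∈ : ∀ i → t i ∈ X) (X⊆ : X ⊆ span (b₀ ∷ t))
    (products-in : ∀ {w z} → w ∈ X → z ∈ X → Ind₂ w z → ¬ ¬ (∀ x y → x ∈ X → y ∈ X → x * y ∈ w ∙ X ⊕ z ∙ X))
    {M} (hyperplane : Enumeration (span t) M) where

    private
      H = span t
      t-ind : Ind t
      t-ind = Ind-tail ind
      open Enumeration hyperplane

      H⊆X : H ⊆ X
      H⊆X = span-⊆ X t∈

      -- The M + 1 elements of the coset b₀ + H; each spans a complement of H in X.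
      z : Fin (suc M) → Carrier
      z η = b₀ + element η

      z∈ : ∀ η → z η ∈ X
      z∈ η = +-mem X b₀∈ (H⊆X (element∈ η))

      components : ∀ {a h} → InF a → h ∈ H → a * b₀ + h ≈ 0# → a ≈ 0# × h ≈ 0#
      components {a} {h} aF (k , kF , h≈) eq = a≈0 , (begin
          h            ≈⟨ +-identityˡ h ⟨
          0# + h       ≈⟨ +-congʳ (trans (*-congʳ a≈0) (zeroˡ b₀)) ⟨
          a * b₀ + h   ≈⟨ eq ⟩
          0#           ∎)
        where
        a≈0 : a ≈ 0#
        a≈0 = trivial ind (a ∷ k) (λ { zero → aF ; (suc i) → kF i })
          (trans (+-congˡ (sym h≈)) eq) zero

      z≉0 : ∀ η → z η ≉ 0#
      z≉0 η eq = 1≉0 (proj₁ (components 1∈F (element∈ η) (trans (+-congʳ (*-identityˡ b₀)) eq)))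

      split : ∀ η {x} → x ∈ X → x ∈ H ⊕ line (z η)
      split η {x} x∈ with k , kF , x≈ ← X⊆ x∈ =
        h - k zero * element η , k zero * z η ,
        minus-mem H (k ∘ suc , kF ∘ suc , refl) (·-mem H (kF zero) (element∈ η)) ,
        ·-mem (line (z η)) (kF zero) (line-gen (z η)) ,
        trans x≈ (begin
          k zero * b₀ + h
            ≈⟨ +-congˡ (y+[x-y]≈x h (k zero * element η)) ⟨
          k zero * b₀ + (k zero * element η + (h - k zero * element η))
            ≈⟨ solve 4 (λ k b y d → k :* b :+ (k :* y :+ d) := d :+ k :* (b :+ y))
                 refl (k zero) b₀ (element η) _ ⟩
          (h - k zero * element η) + k zero * z η                           ∎)
        where
        h = comb (k ∘ suc) t

      disjoint : ∀ η {x} → x ∈ H → x ∈ line (z η) → x ≈ 0#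
      disjoint η {x} x∈ (Level.lift (a , aF , x≈)) = trans x≈ (trans (*-congʳ a≈0) (zeroˡ (z η)))
        where
        a≈0 : a ≈ 0#
        a≈0 = proj₁ (components aF (minus-mem H (·-mem H aF (element∈ η)) x∈) (begin
          a * b₀ + (a * element η - x)   ≈⟨ +-assoc _ _ _ ⟨
          a * b₀ + a * element η - x     ≈⟨ +-congʳ (distribˡ a b₀ (element η)) ⟨
          a * z η - x                    ≈⟨ +-congʳ x≈ ⟨
          x - x                          ≈⟨ -‿inverseʳ x ⟩
          0#                             ∎))

      -- The coefficient of b₀ gives a = -b, and the component in H then identifies the two elements
      -- of H unless a = 0.
      coprime : ∀ η θ → ¬ (η ≡ θ) → Ind₂ (z η) (z θ)
      coprime η θ η≢θ {a} {b} aF bF eq = a≈0 , b≈0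
        where
        both : a + b ≈ 0# × a * element η + b * element θ ≈ 0#
        both = components (F-+ aF bF) (+-mem H (·-mem H aF (element∈ η)) (·-mem H bF (element∈ θ)))
          (trans (solve 5 (λ a b s x y → (a :+ b) :* s :+ (a :* x :+ b :* y) := a :* (s :+ x) :+ b :* (s :+ y))
            refl a b b₀ (element η) (element θ)) eq)
        a≈-b : a ≈ - b
        a≈-b = +-inverseˡ-unique a b (proj₁ both)
        a≈0 : a ≈ 0#
        a≈0 = decidable-stable (F-≟ aF 0∈F) λ a≉0 → η≢θ (distinct (*-cancelˡ a≉0 (begin
          a * element η      ≈⟨ +-inverseˡ-unique _ _ (proj₂ both) ⟩
          - (b * element θ)  ≈⟨ -‿distribˡ-* b (element θ) ⟩
          - b * element θ    ≈⟨ *-congʳ a≈-b ⟨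
          a * element θ      ∎)))
        b≈0 : b ≈ 0#
        b≈0 = trans (sym (+-identityˡ b)) (trans (+-congʳ (sym a≈0)) (proj₁ both))

      u = t zero
      v = t (suc zero)
      u∈ : u ∈ H
      u∈ = span-gen t zero
      v∈ : v ∈ H
      v∈ = span-gen t (suc zero)

    -- There are M + 1 hyperplane translates z η, pairwise coprime, but u ^ M − v ^ M has degree M.
    too-many-divisors : ⊥
    too-many-divisors = products-in b₀∈ (t∈ zero) ind₀ λ base →
      let open Graded X (suc e) dX (λ {w} {z} → products-in {w} {z}) b₀ u
                 b₀∈ (t∈ zero) ind₀ base
      -- The one hyperplane H complements every divisor, so the same u, v and M serve for all of
      -- them.
      in ¬¬-choice (λ η → Fermat.fermat (z∈ η) H⊆X hyperplane (split η) (disjoint η) (z≉0 η)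
                            u∈ v∈ (Ind-≉0 t-ind zero) (Ind-≉0 t-ind (suc zero)))
           λ divides → vanish M z (ℕₚ.n<1+n M) z∈ coprime divides λ f≈0 →
             finish (ratio (Ind⇒Ind₂ t-ind)) (nonzero-complete u∈ (Ind-≉0 t-ind zero)) (x-y≈0⇒x≈y f≈0)
      where
      ind₀ : Ind₂ b₀ u
      ind₀ = Ind⇒Ind₂ ind
      finish : (∃ λ r → u * r ≈ v × ¬ InF r) → (∃ λ (i : Fin M) → u ≈ nonzero i) → u ^ M ≈ v ^ M → ⊥
      finish (r , ur≈v , r∉F) (i , _) eq = r∉F (equal-powers⇒F i (Ind-≉0 t-ind zero) ur≈v eq)

  -- The tail of a basis spans the hyperplane. Dimension at least 3 leaves two independent vectors
  -- in that tail, whose ratio is outside F yet a root of unity.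
  no-large-atom : ∀ {X e} → Dim X (suc (suc (suc e))) →
    (∀ {w z} → w ∈ X → z ∈ X → Ind₂ w z → ¬ ¬ (∀ x y → x ∈ X → y ∈ X → x * y ∈ w ∙ X ⊕ z ∙ X)) → ⊥
  no-large-atom {X} {e} dX products-in =
    too-many-divisors {X} {e} {b₀} {t} ind (mkDim (b₀ ∷ t) ind cons∈ X⊆)
      (contained dX zero) (λ i → contained dX (suc i)) X⊆
      (λ {w} {z} → products-in {w} {z}) (proj₂ (enumerate (Ind-tail ind)))
    where
    b₀ = basis dX zero
    t : Fin (suc (suc e)) → Carrier
    t i = basis dX (suc i)
    ind : Ind (b₀ ∷ t)
    ind = mkInd λ k kF eq → trivial (independent dX) k kF eq
    cons∈ : ∀ i → (b₀ ∷ t) i ∈ X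
    cons∈ zero = contained dX zero
    cons∈ (suc i) = contained dX (suc i)
    X⊆ : X ⊆ span (b₀ ∷ t)
    X⊆ x∈ = spanning dX x∈

-- Descent to a plane, and bases by finite search

module Conclusion {c ℓ} (L : CommutativeRing c ℓ) (isField : FieldTheory.IsField L)
  (q : ℕ) (ι : Fin q → CommutativeRing.Carrier L)
  (isSubfield : FieldTheory.IsFiniteSubfield L q ι)
  (algebraic⇒F : ∀ x → FieldTheory.Over.Algebraic L q ι x → FieldTheory.Over.InF L q ι x) where

  open LargeAtoms L isField q ι isSubfield algebraic⇒F public
  open CommutativeRing L hiding (zero)
  open FieldTheory L
  open Over q ι
  open import Algebra.Properties.Semiring.Exp semiring using (_^_)
  open import Algebra.Solver.Ring.NaturalCoefficients.Default commutativeSemiring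
    using (solve; _:=_; _:+_; _:*_)
  open import Relation.Binary.Reasoning.Setoid setoid

  -- Descent replaces the choice of a least critical space: under the assumption `none`, the
  -- induction hypothesis excludes critical spaces of smaller dimension at least 2, so X is an atom.
  critical⇒ratio : ∀ {T n} (dT : Dim T (suc n)) bound {X d} → d ≤ bound → 2 ≤ d → Critical T n dT X d →
                   ¬ ¬ ∃ λ a → ¬ InF a × Progression T (suc n) a
  critical⇒ratio {T} {n} dT (suc bound) {X} {suc (suc zero)} _ _ crit = critical-plane⇒ratio T n dT crit
  critical⇒ratio {T} {n} dT (suc bound) {X} {suc (suc (suc e))} d≤ _ crit none =
    no-large-atom (dim crit) (λ {w} {z} → Atom.atom-products T n dT crit minimal {w} {z})
    where
    minimal : ∀ {Y f} → Critical T n dT Y f → 2 ≤ f → suc (suc (suc e)) ≤ f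
    minimal critY 2≤f = ℕₚ.≮⇒≥ λ f<d →
      critical⇒ratio dT bound (ℕₚ.≤-pred (ℕₚ.≤-trans f<d d≤)) 2≤f critY none
  critical⇒ratio dT (suc bound) {d = suc zero} _ (s≤s ()) _

  progressions : ∀ {S T P m n p} → Dim S (suc (suc m)) → Dim T (suc (suc n)) → Dim P p → Covers S T P →
    p ≤ suc (suc m) ℕ.+ suc n →
    ¬ ¬ ∃ λ a → ¬ InF a × Progression S (suc (suc m)) a × Progression T (suc (suc n)) a
  progressions {S} {T} {P} dS dT dP cov p≤ = do
    -- S itself is critical, with cover P, and starts the descent.
    a , a∉F , inT ← critical⇒ratio dT _ ℕₚ.≤-refl (s≤s (s≤s z≤n)) (mkCritical dS P dP cov p≤)
    inS ← transfer-progression {S} {T} {P} dS inT a∉F cov dP p≤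
    return (a , a∉F , inS , inT)

  LinIndep⇒Ind : ∀ {n} {w : Fin n → Carrier} → LinIndep w → Ind w
  LinIndep⇒Ind lin = mkInd λ k kF eq i → trans (proj₂ (kF i))
    (lin (λ j → proj₁ (kF j)) (trans (comb-cong (λ j → sym (proj₂ (kF j)))) eq) i)

  ∈span⇒InSpan : ∀ {n x} (w : Fin n → Carrier) → x ∈ span w → InSpan w x
  ∈span⇒InSpan w (k , kF , eq) = (λ i → proj₁ (kF i)) , trans eq (comb-cong (λ i → proj₂ (kF i)))

  InSpan⇒∈span : ∀ {n x} (w : Fin n → Carrier) → InSpan w x → x ∈ span w
  InSpan⇒∈span w (k , eq) = (λ i → ι (k i)) , (λ i → k i , refl) , eq

  geom-LinIndep : ∀ {g a} n → g ≉ 0# → ¬ InF a → LinIndep (geom (suc n) g a)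
  geom-LinIndep {g} {a} n g≉0 a∉F k eq i = decidable-stable (F-≟ (k i , refl) 0∈F) λ ki≉0 →
    a∉F (algebraic⇒F a (n , k , (i , ki≉0) ,
      x*y≈0⇒y≈0 g≉0 (trans (comb-scaleʳ g (λ j → ι (k j)) (λ j → a ^ toℕ j)) eq)))

  geom-basis : ∀ {g a n} {s : Fin (suc n) → Carrier} → Ind s → g ≉ 0# → ¬ InF a →
               (∀ i → geom (suc n) g a i ∈ span s) → IsBasisOf (geom (suc n) g a) s
  geom-basis {g} {a} {n} {s} ind g≉0 a∉F in-span = lin , (λ i → ∈span⇒InSpan s (in-span i)) ,
    λ j → ∈span⇒InSpan (geom (suc n) g a)
      (Ind-spans (LinIndep⇒Ind {w = geom (suc n) g a} lin) in-span (Dim-span ind) (span-gen s j))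
    where
    lin = geom-LinIndep n g≉0 a∉F

  -- For x in S and y in T, all the products compared here lie in ST, where equality is decidable;
  -- x i ≈ x 0 * a ^ i itself could not be tested.
  Proportional : ∀ {m n} → (Fin (suc (suc m)) → Carrier) → (Fin (suc (suc n)) → Carrier) → Set ℓ
  Proportional x y =
    x zero ≉ 0# × y zero ≉ 0# × ¬ (∃ λ i → y (suc zero) ≈ ι i * y zero) ×
    (∀ i → x (suc i) * y zero ≈ x (Fin.inject₁ i) * y (suc zero)) ×
    (∀ j → x zero * y (suc j) ≈ x (suc zero) * y (Fin.inject₁ j))

  geometric⇒proportional : ∀ {m n g h a} {x : Fin (suc (suc m)) → Carrier} {y : Fin (suc (suc n)) → Carrier} →
    g ≉ 0# → h ≉ 0# → ¬ InF a → (∀ i → x i ≈ g * a ^ toℕ i) → (∀ j → y j ≈ h * a ^ toℕ j) → Proportional x y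
  geometric⇒proportional {g = g} {h} {a} {x} {y} g≉0 h≉0 a∉F x≈ y≈ =
    (λ z → g≉0 (trans (sym x₀≈g) z)) , (λ z → h≉0 (trans (sym y₀≈h) z)) ,
    (λ (i , eq) → a∉F (i , *-cancelˡ h≉0 (trans (sym y₁≈ha) (trans eq (trans (*-congˡ y₀≈h) (*-comm (ι i) h)))))) ,
    (λ i → begin
      x (suc i) * y zero                              ≈⟨ *-cong (x≈ (suc i)) y₀≈h ⟩
      g * (a * a ^ toℕ i) * h
        ≈⟨ solve 4 (λ g a s h → g :* (a :* s) :* h := g :* s :* (h :* a)) refl g a (a ^ toℕ i) h ⟩
      g * a ^ toℕ i * (h * a)
        ≈⟨ *-cong (trans (x≈ (Fin.inject₁ i)) (*-congˡ (reflexive (≡.cong (a ^_) (Finₚ.toℕ-inject₁ i))))) y₁≈ha ⟨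
      x (Fin.inject₁ i) * y (suc zero)                ∎) ,
    (λ j → begin
      x zero * y (suc j)                              ≈⟨ *-cong x₀≈g (y≈ (suc j)) ⟩
      g * (h * (a * a ^ toℕ j))
        ≈⟨ solve 4 (λ g a s h → g :* (h :* (a :* s)) := g :* a :* (h :* s)) refl g a (a ^ toℕ j) h ⟩
      g * a * (h * a ^ toℕ j)
        ≈⟨ *-cong x₁≈ga (trans (y≈ (Fin.inject₁ j)) (*-congˡ (reflexive (≡.cong (a ^_) (Finₚ.toℕ-inject₁ j))))) ⟨
      x (suc zero) * y (Fin.inject₁ j)                ∎)
    where
    x₀≈g = trans (x≈ zero) (*-identityʳ g)
    y₀≈h = trans (y≈ zero) (*-identityʳ h)
    x₁≈ga = trans (x≈ (suc zero)) (*-congˡ (*-identityʳ a))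
    y₁≈ha = trans (y≈ (suc zero)) (*-congˡ (*-identityʳ a))

  recurrence⇒geometric : ∀ {n a} (x : Fin (suc n) → Carrier) →
    (∀ i → x (suc i) ≈ x (Fin.inject₁ i) * a) → ∀ i → x i ≈ x zero * a ^ toℕ i
  recurrence⇒geometric x rec zero = sym (*-identityʳ _)
  recurrence⇒geometric {suc n} {a} x rec (suc i) = begin
    x (suc i)                          ≈⟨ rec i ⟩
    x (Fin.inject₁ i) * a
      ≈⟨ *-congʳ (recurrence⇒geometric (x ∘ Fin.inject₁) (λ j → rec (Fin.inject₁ j)) i) ⟩
    x zero * a ^ toℕ i * a
      ≈⟨ solve 3 (λ x s a → x :* s :* a := x :* (a :* s)) refl (x zero) (a ^ toℕ i) a ⟩
    x zero * (a * a ^ toℕ i)           ∎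

  -- The ratio a = y₁/y₀ is read off from y and carried to x by cancelling y₀; then x₁ = x₀a carries
  -- it back to all of y by cancelling x₀.
  proportional⇒bases : ∀ {m n} {s x : Fin (suc (suc m)) → Carrier} {t y : Fin (suc (suc n)) → Carrier} →
    Ind s → Ind t → (∀ i → x i ∈ span s) → (∀ j → y j ∈ span t) → Proportional x y →
    ∃ λ g → ∃ λ h → ∃ λ a → IsBasisOf (geom (suc (suc m)) g a) s × IsBasisOf (geom (suc (suc n)) h a) t
  proportional⇒bases {s = s} {x} {t} {y} inds indt x∈ y∈ (x₀≉0 , y₀≉0 , y₁∉ , recx , recy)
    with y₀⁻¹ , inv ← inverse y₀≉0 = x zero , y zero , a ,
      geom-basis inds x₀≉0 a∉F (λ i → resp (span s) (recurrence⇒geometric x x-step i) (x∈ i)) ,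
      geom-basis indt y₀≉0 a∉F (λ j → resp (span t) (recurrence⇒geometric y y-step j) (y∈ j))
    where
    a = y₀⁻¹ * y (suc zero)
    y₀a≈y₁ : y zero * a ≈ y (suc zero)
    y₀a≈y₁ = trans (sym (*-assoc _ _ _)) (trans (*-congʳ inv) (*-identityˡ _))
    a∉F : ¬ InF a
    a∉F (i , a≈) = y₁∉ (i , trans (sym y₀a≈y₁) (trans (*-comm _ a) (*-congʳ a≈)))
    x-step : ∀ i → x (suc i) ≈ x (Fin.inject₁ i) * a
    x-step i = *-cancelˡ y₀≉0 (begin
      y zero * x (suc i)                 ≈⟨ *-comm _ _ ⟩
      x (suc i) * y zero                 ≈⟨ recx i ⟩
      x (Fin.inject₁ i) * y (suc zero)   ≈⟨ *-congˡ y₀a≈y₁ ⟨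
      x (Fin.inject₁ i) * (y zero * a)
        ≈⟨ solve 3 (λ x y a → x :* (y :* a) := y :* (x :* a)) refl _ (y zero) a ⟩
      y zero * (x (Fin.inject₁ i) * a)   ∎)
    y-step : ∀ j → y (suc j) ≈ y (Fin.inject₁ j) * a
    y-step j = *-cancelˡ x₀≉0 (begin
      x zero * y (suc j)                 ≈⟨ recy j ⟩
      x (suc zero) * y (Fin.inject₁ j)   ≈⟨ *-congʳ (x-step zero) ⟩
      x zero * a * y (Fin.inject₁ j)     ≈⟨ solve 3 (λ x a y → x :* a :* y := x :* (y :* a)) refl (x zero) a _ ⟩
      x zero * (y (Fin.inject₁ j) * a)   ∎)

  module _ {m n} {s : Fin m → Carrier} {t : Fin n → Carrier} where

    private
      products-combine : ∀ i j → products s t (combine i j) ≈ s i * t j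
      products-combine i j = reflexive
        (≡.cong (λ p → s (proj₁ p) * t (proj₂ p)) (Finₚ.remQuot-combine {m} i j))

    span-products : ∀ {x y} → x ∈ span s → y ∈ span t → x * y ∈ span (products s t)
    span-products {x} {y} x∈ y∈ = span-⊆ (colon P x)
      (λ j → resp P (*-comm (t j) x) (span-⊆ (colon P (t j))
        (λ i → resp P (trans (products-combine i j) (*-comm (s i) (t j))) (span-gen (products s t) (combine i j))) x∈)) y∈
      where
      P = span (products s t)

  progression-bases : ∀ {m n} {s : Fin (suc (suc m)) → Carrier} {t : Fin (suc (suc n)) → Carrier} →
    LinIndep s → LinIndep t → HasDim (products s t) (suc (suc m) ℕ.+ suc n) →
    ∃ λ g → ∃ λ h → ∃ λ a → IsBasisOf (geom (suc (suc m)) g a) s × IsBasisOf (geom (suc (suc n)) h a) t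
  progression-bases {m} {n} {s} {t} s-lin t-lin (w , w-lin , _ , products∈w) = conclude
    (decidable-stable (Finₚ.any? λ i → Finₚ.any? λ j → proportional? i j) search)
    where
    inds = LinIndep⇒Ind {w = s} s-lin
    indt = LinIndep⇒Ind {w = t} t-lin
    indw = LinIndep⇒Ind {w = w} w-lin
    product∈ : ∀ {x y} → x ∈ span s → y ∈ span t → x * y ∈ span w
    product∈ x∈ y∈ = span-⊆ (span w) (λ k → InSpan⇒∈span w (products∈w k)) (span-products {s = s} {t} x∈ y∈)

    -- One number codes d vectors of the span, each by one of its q ^ d coefficient vectors; thus
    -- two bounded quantifiers reach every candidate pair of families.
    family : ∀ {d} → (Fin d → Carrier) → Fin ((q ℕ.^ d) ℕ.^ d) → Fin d → Carrier
    family {d} b code i = comb (λ j → ι (finToFun {q} {d} (finToFun {q ℕ.^ d} {d} code i) j)) b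
    family∈ : ∀ {d} (b : Fin d → Carrier) code i → family b code i ∈ span b
    family∈ b code i = _ , (λ j → _ , refl) , refl
    encode : ∀ {d} (b x : Fin d → Carrier) → (∀ i → x i ∈ span b) → ∃ λ code → ∀ i → family b code i ≈ x i
    encode {d} b x x∈ = funToFin (λ i → funToFin (index i)) , λ i → sym (trans (proj₂ (proj₂ (x∈ i)))
      (comb-cong (λ j → trans (proj₂ (proj₁ (proj₂ (x∈ i)) j)) (reflexive (≡.cong ι (≡.sym
        (≡.trans (≡.cong (λ code → finToFun {q} {d} code j) (Finₚ.finToFun-funToFin (λ i → funToFin (index i)) i))
                 (Finₚ.finToFun-funToFin (index i) j))))))))
      where
      index : Fin d → Fin d → Fin q
      index i j = proj₁ (proj₁ (proj₂ (x∈ i)) j)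

    proportional? : ∀ i j → Dec (Proportional (family s i) (family t j))
    proportional? i j =
      ¬? (span-≟ inds (x∈ zero) (0-mem (span s))) ×-dec
      ¬? (span-≟ indt (y∈ zero) (0-mem (span t))) ×-dec
      ¬? (Finₚ.any? λ k → span-≟ indt (y∈ (suc zero)) (·-mem (span t) (k , refl) (y∈ zero))) ×-dec
      Finₚ.all? (λ k → span-≟ indw (product∈ (x∈ (suc k)) (y∈ zero)) (product∈ (x∈ (Fin.inject₁ k)) (y∈ (suc zero)))) ×-dec
      Finₚ.all? (λ k → span-≟ indw (product∈ (x∈ zero) (y∈ (suc k))) (product∈ (x∈ (suc zero)) (y∈ (Fin.inject₁ k))))
      where
      x∈ = family∈ s i
      y∈ = family∈ t j

    search : ¬ ¬ ∃ λ i → ∃ λ j → Proportional (family s i) (family t j)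
    search = do
      a , a∉F , (g , g≉0 , inS) , (h , h≉0 , inT) ←
        progressions (Dim-span inds) (Dim-span indt) (Dim-span indw) product∈ ℕₚ.≤-refl
      let i , x≈ = encode s (geom _ g a) (λ k → inS (toℕ k) (Finₚ.toℕ<n k))
          j , y≈ = encode t (geom _ h a) (λ k → inT (toℕ k) (Finₚ.toℕ<n k))
      return (i , j , geometric⇒proportional g≉0 h≉0 a∉F x≈ y≈)

    conclude : (∃ λ i → ∃ λ j → Proportional (family s i) (family t j)) → _
    conclude (i , j , prop) = proportional⇒bases inds indt (family∈ s i) (family∈ t j) prop


open import Data.Nat using (_+_; _∸_)

theorem7p2 : ∀ {c ℓ} (L : CommutativeRing c ℓ) →
  let open CommutativeRing L using (Carrier)
      open FieldTheory L
  in IsField →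
     (q : ℕ) (ι : Fin q → Carrier) → IsFiniteSubfield q ι →
     let open Over q ι
     in InfiniteExtension →
        (∀ x → Algebraic x → InF x) →
        (m n : ℕ) (s : Fin m → Carrier) (t : Fin n → Carrier) →
        LinIndep s → LinIndep t →
        2 ≤ m → 2 ≤ n →
        HasDim (products s t) (m + n ∸ 1) →
        ∃ λ g → ∃ λ g′ → ∃ λ a →
          IsBasisOf (geom m g a) s × IsBasisOf (geom n g′ a) t
theorem7p2 L isField q ι isSubfield _ algebraic⇒F (suc (suc m)) (suc (suc n)) s t s-lin t-lin _ _ hasDim =
  Conclusion.progression-bases L isField q ι isSubfield algebraic⇒F {s = s} {t} s-lin t-lin
    -- Here m + n ∸ 1 computes to `suc m + suc (suc n)`; the successor has to move to the left
    -- summand.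
    (≡.subst (HasDim (products s t)) (ℕₚ.+-suc (suc m) (suc n)) hasDim)
  where
  open FieldTheory.Over L q ι
theorem7p2 L isField q ι isSubfield _ algebraic⇒F (suc zero) n s t s-lin t-lin (s≤s ()) _ hasDim
theorem7p2 L isField q ι isSubfield _ algebraic⇒F (suc (suc m)) (suc zero) s t s-lin t-lin _ (s≤s ()) hasDim
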